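{- Fix an integer $k\ge 2$ and positive integers $n,p_1,\ldots,p_k$ such that $\mathcal{M}^n_{p_1,\ldots,p_k}$ is nonempty. Consider the uniform distribution on pairs $B=((i_1,\ldots,i_{k-1}),(R_1,\ldots,R_n))$ such that $i_1,\ldots,i_{k-1}$ are integers in $[n]$ (repetitions allowed) and $(R_1,\ldots,R_n)\in\mathcal{M}^n_{p_1,\ldots,p_k}$. Then the probability that the graph $\alpha(B)$ is a tree is equal to the probability that the subset $R_1$ has cardinality $k-1$.
   Context: $[m]=\{1,\ldots,m\}$. $\mathcal{M}^n_{p_1,\ldots,p_k}$ is the set of $n$-tuples $(R_1,\ldots,R_n)$ of strict subsets of $[k]$ such that each $t\in[k]$ belongs to exactly $p_t$ of the subsets $R_1,\ldots,R_n$. For $t\in[k]$ and $R\subsetneq[k]$, the element $\alpha(t,R)\in[k]$ is defined, with all integers taken modulo $k$ (representatives in $[k]$), by: $\alpha(t,R)=t-1$ if $t\in R$; and $\alpha(t,R)=t+r$ if $t\notin R$, where $r\ge0$ is the integer such that $t+1,\ldots,t+r\in R$ and $t+r+1\notin R$. For $i_1,\ldots,i_{k-1}\in[n]$ and $R_1,\ldots,R_n\subsetneq[k]$, $\alpha((i_1,\ldots,i_{k-1}),(R_1,\ldots,R_n))$ is the undirected graph (loops and multiple edges allowed) with vertex set $[k]$ and $k-1$ edges $e_1,\ldots,e_{k-1}$, where $e_t=\{t,\alpha(t,R_{i_t})\}$. -}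

module Defs where

open import Data.Bool.Base using (true; false)
open import Data.Fin.Base using (Fin; zero; suc; toℕ; inject₁)
open import Data.Fin.Properties using (_≟_; any?; all?; injective⇒≤; toℕ-fromℕ<; toℕ<n; toℕ-injective)
import Data.Fin.Subset as Sub
open Sub using (Subset; ⊤; _⊂_)
open import Data.Fin.Subset.Properties using (_∈?_; _⊂?_)
open import Data.Integer.Base using (+_)
open import Data.List.Base using (List; []; _∷_; length; filter; allFin; cartesianProduct; cartesianProductWith)
open import Data.List.Membership.Propositional using (_∈_; lose; find)
open import Data.List.Membership.Propositional.Properties
  using (∈-cartesianProductWith⁺; ∈-cartesianProduct⁺; ∈-cartesianProduct⁻; ∈-filter⁺; ∈-filter⁻; ∈-allFin; ∈-length)
import Data.List.Relation.Unary.All as All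
import Data.List.Relation.Unary.AllPairs as AllPairs
open import Data.List.Relation.Unary.Any as Any using (here; there)
open import Data.List.Relation.Unary.Unique.Propositional using (Unique)
import Data.List.Relation.Unary.Unique.Propositional.Properties as Uniqueₚ
open import Data.Nat as ℕ using (ℕ; zero; suc; _+_; _≤_; _<_; s≤s; >-nonZero)
import Data.Nat.DivMod as DivMod
open DivMod using (_mod_)
import Data.Nat.Properties as ℕₚ
open import Data.Product using (Σ; Σ-syntax; ∃; ∃-syntax; _×_; _,_; proj₁; proj₂)
open import Data.Product.Properties using (≡-dec)
open import Data.Rational.Base using (ℚ; _/_)
open import Data.Sum using (_⊎_; inj₁; inj₂)
open import Data.Vec.Base as Vec using (Vec; []; _∷_; lookup)
open import Data.Vec.Properties using (∷-injective)
open import Function.Definitions using (Injective)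
open import Level using (Level)
open import Relation.Binary using (Rel) renaming (Decidable to Decidable₂)
open import Relation.Binary.Construct.Closure.ReflexiveTransitive using (Star; ε; _◅_; _◅◅_)
open import Relation.Binary.PropositionalEquality using (_≡_; refl; sym; trans; subst)
open import Relation.Nullary using (¬_; Dec; yes; no; ¬?)
open import Relation.Nullary.Decidable using (map′; _×-dec_; _⊎-dec_; _→-dec_)
open import Relation.Unary using (Pred; Decidable)

private variable
  a ℓ : Level
  A   : Set a
  m n v e : ℕ

-- Vertex set Fin v, edges labelled by Fin e.  The order of the two endpoints
-- is only ever used through `Joins`, which is symmetric.
Multigraph : ℕ → ℕ → Set
Multigraph v e = Fin e → Fin v × Fin v

module _ (G : Multigraph v e) where

  Joins : Fin e → Fin v → Fin v → Set
  Joins a x y = G a ≡ (x , y) ⊎ G a ≡ (y , x)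

  Adjacent : Fin v → Fin v → Set
  Adjacent x y = ∃[ a ] Joins a x y

  Connected : Set
  Connected = ∀ x y → Star Adjacent x y

  -- A cycle x₀ —d₀— x₁ —d₁— … —dₗ— x₀ of length l + 1, with distinct vertices
  -- and distinct edges: a loop has l = 0, a pair of parallel edges l = 1.
  IsCycle : ∀ {l} → Vec (Fin v) (suc l) → Vec (Fin e) (suc l) → Set
  IsCycle {l} xs ds =
    Injective _≡_ _≡_ (lookup xs) ×
    Injective _≡_ _≡_ (lookup ds) ×
    (∀ i → Joins (lookup ds i) (lookup xs i) (lookup xs (suc (toℕ i) mod suc l)))

  Acyclic : Set
  Acyclic = ∀ {l} (xs : Vec (Fin v) (suc l)) (ds : Vec (Fin e) (suc l)) → ¬ IsCycle xs ds

  IsTree : Set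
  IsTree = Connected × Acyclic

-- Addition of an integer modulo k = suc m; the element t ∈ [k] is represented
-- by t − 1 in Fin (suc m).
infixl 6 _⊕_
_⊕_ : Fin (suc m) → ℕ → Fin (suc m)
_⊕_ {m} t r = (toℕ t + r) mod suc m

⊕-period : (t : Fin (suc m)) → t ⊕ suc m ≡ t
⊕-period {m} t = toℕ-injective (trans (toℕ-fromℕ< _)
  (trans (DivMod.[m+n]%n≡m%n (toℕ t) (suc m)) (DivMod.m<n⇒m%n≡m (toℕ<n t))))

IsRun : Fin (suc m) → Subset (suc m) → ℕ → Set
IsRun t R r = (∀ j → 1 ≤ j → j ≤ r → t ⊕ j Sub.∈ R) × t ⊕ suc r Sub.∉ R

run : (t : Fin (suc m)) (R : Subset (suc m)) → t Sub.∉ R → ∃[ r ] IsRun t R r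
run {m} t R t∉R = go m 0 (ℕₚ.+-identityʳ m) λ { (suc _) _ () }
  where
  go : ∀ fuel r → fuel + r ≡ m → (∀ j → 1 ≤ j → j ≤ r → t ⊕ j Sub.∈ R) → ∃[ r ] IsRun t R r
  go zero       r refl in-R = r , in-R , subst (Sub._∉ R) (sym (⊕-period t)) t∉R
  go (suc fuel) r eq   in-R with t ⊕ suc r ∈? R
  ... | no  t+r+1∉R = r , in-R , t+r+1∉R
  ... | yes t+r+1∈R = go fuel (suc r) (trans (ℕₚ.+-suc fuel r) eq) in-R′
    where
    in-R′ : ∀ j → 1 ≤ j → j ≤ suc r → t ⊕ j Sub.∈ R
    in-R′ j 1≤j j≤1+r with ℕₚ.m≤n⇒m<n∨m≡n j≤1+r
    ... | inj₁ (s≤s j≤r) = in-R j 1≤j j≤r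
    ... | inj₂ refl      = t+r+1∈R

-- In the first case, t ⊕ m is t − 1 modulo suc m.
α : Fin (suc m) → Subset (suc m) → Fin (suc m)
α {m} t R with t ∈? R
... | yes _   = t ⊕ m
... | no  t∉R = t ⊕ proj₁ (run t R t∉R)

-- The pairs ((i₁,…,i_{k-1}), (R₁,…,R_n)), with k = suc m.
Pairs : ℕ → ℕ → Set
Pairs m n = Vec (Fin n) m × Vec (Subset (suc m)) n

graph : Pairs m n → Multigraph (suc m) m
graph (is , Rs) t = inject₁ t , α (inject₁ t) (lookup Rs (lookup is t))

infix 4 _∈𝓜_
_∈𝓜_ : Vec (Subset (suc m)) n → (Fin (suc m) → ℕ) → Set
Rs ∈𝓜 p = (∀ i → lookup Rs i ⊂ ⊤) × (∀ t → Vec.count (t ∈?_) Rs ≡ p t)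

vectors : List A → ∀ n → List (Vec A n)
vectors xs zero    = [] ∷ []
vectors xs (suc n) = cartesianProductWith _∷_ xs (vectors xs n)

∈-vectors : {xs : List A} → (∀ x → x ∈ xs) → (ys : Vec A n) → ys ∈ vectors xs n
∈-vectors all []       = here refl
∈-vectors all (y ∷ ys) = ∈-cartesianProductWith⁺ _∷_ (all y) (∈-vectors all ys)

vectors-unique : {xs : List A} → Unique xs → ∀ n → Unique (vectors xs n)
vectors-unique u zero    = All.[] AllPairs.∷ AllPairs.[]
vectors-unique u (suc n) = Uniqueₚ.cartesianProductWith⁺ _∷_ ∷-injective u (vectors-unique u n)

subsets : ∀ k → List (Subset k)
subsets = vectors (true ∷ false ∷ [])

∈-subsets : ∀ {k} (R : Subset k) → R ∈ subsets k
∈-subsets = ∈-vectors λ { true → here refl ; false → there (here refl) }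

subsets-unique : ∀ k → Unique (subsets k)
subsets-unique = vectors-unique (((λ ()) All.∷ All.[]) AllPairs.∷ All.[] AllPairs.∷ AllPairs.[])

_∈𝓜?_ : (Rs : Vec (Subset (suc m)) n) (p : Fin (suc m) → ℕ) → Dec (Rs ∈𝓜 p)
Rs ∈𝓜? p = all? (λ i → lookup Rs i ⊂? ⊤) ×-dec all? (λ t → Vec.count (t ∈?_) Rs ℕ.≟ p t)

𝓜 : ∀ n → (Fin (suc m) → ℕ) → List (Vec (Subset (suc m)) n)
𝓜 {m} n p = filter (_∈𝓜? p) (vectors (subsets (suc m)) n)

-- The sample space; by the next three lemmas it lists every pair B with
-- (R₁,…,R_n) ∈ 𝓜 exactly once.
samples : ∀ n → (Fin (suc m) → ℕ) → List (Pairs m n)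
samples {m} n p = cartesianProduct (vectors (allFin n) m) (𝓜 n p)

∈-samples⁺ : {p : Fin (suc m) → ℕ} (is : Vec (Fin n) m) (Rs : Vec (Subset (suc m)) n) →
             Rs ∈𝓜 p → (is , Rs) ∈ samples n p
∈-samples⁺ {p = p} is Rs Rs∈𝓜 =
  ∈-cartesianProduct⁺ (∈-vectors ∈-allFin is) (∈-filter⁺ (_∈𝓜? p) (∈-vectors ∈-subsets Rs) Rs∈𝓜)

∈-samples⁻ : {p : Fin (suc m) → ℕ} {B : Pairs m n} → B ∈ samples n p → proj₂ B ∈𝓜 p
∈-samples⁻ {m = m} {n = n} {p = p} B∈ =
  proj₂ (∈-filter⁻ (_∈𝓜? p) {xs = vectors (subsets (suc m)) n}
    (proj₂ (∈-cartesianProduct⁻ (vectors (allFin n) m) (𝓜 n p) B∈)))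

samples-unique : ∀ n (p : Fin (suc m) → ℕ) → Unique (samples n p)
samples-unique {m} n p = Uniqueₚ.cartesianProduct⁺
  (vectors-unique (Uniqueₚ.allFin⁺ n) m)
  (Uniqueₚ.filter⁺ (_∈𝓜? p) (vectors-unique (subsets-unique (suc m)) n))

samples-nonempty : ∀ n (p : Fin (suc m) → ℕ) →
                   Σ[ Rs ∈ Vec (Subset (suc m)) (suc n) ] Rs ∈𝓜 p → 0 < length (samples (suc n) p)
samples-nonempty n p (Rs , Rs∈𝓜) = ∈-length (∈-samples⁺ {p = p} (Vec.replicate _ zero) Rs Rs∈𝓜)

-- The probability of P for the uniform distribution on the entries of a
-- nonempty list without repetitions.
ℙ : {P : Pred A ℓ} (xs : List A) → 0 < length xs → Decidable P → ℚ
ℙ xs 0<∣xs∣ P? = (+ length (filter P? xs) / length xs) {{>-nonZero 0<∣xs∣}}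

∃-dec : ∀ {p} {P : Pred A p} (xs : List A) → (∀ x → x ∈ xs) → Decidable P → Dec (∃ P)
∃-dec xs all P? = map′ (λ h → let x , _ , px = find h in x , px)
                       (λ (x , px) → lose (all x) px)
                       (Any.any? P? xs)

-- Reachability by Warshall's algorithm: `Via j x y` is reachability through
-- intermediate vertices of value less than j.
module _ {R : Rel (Fin v) Level.zero} (R? : Decidable₂ R) where

  private
    Via : ℕ → Fin v → Fin v → Set
    Via zero    x y = x ≡ y ⊎ R x y
    Via (suc j) x y = Via j x y ⊎ ∃[ z ] (toℕ z ≡ j × Via j x z × Via j z y)

    via? : ∀ j x y → Dec (Via j x y)
    via? zero    x y = (x ≟ y) ⊎-dec R? x y
    via? (suc j) x y =
      via? j x y ⊎-dec any? (λ z → (toℕ z ℕ.≟ j) ×-dec (via? j x z ×-dec via? j z y))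

    sound : ∀ j {x y} → Via j x y → Star R x y
    sound zero    (inj₁ refl) = ε
    sound zero    (inj₂ r)    = r ◅ ε
    sound (suc j) (inj₁ p)    = sound j p
    sound (suc j) (inj₂ (_ , _ , p , q)) = sound j p ◅◅ sound j q

    base : ∀ j {x y} → Via 0 x y → Via j x y
    base zero    p = p
    base (suc j) p = inj₁ (base j p)

    join : ∀ j {x y z} → toℕ y < j → Via j x y → Via j y z → Via j x z
    join (suc j) {y = y} (s≤s y≤j) p q with ℕₚ.m≤n⇒m<n∨m≡n y≤j
    join (suc j) _ (inj₁ p) (inj₁ q) | inj₁ y<j = inj₁ (join j y<j p q)
    join (suc j) _ (inj₁ p) (inj₂ (w , eq , q , q′)) | inj₁ y<j = inj₂ (w , eq , join j y<j p q , q′)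
    join (suc j) _ (inj₂ (w , eq , p , p′)) (inj₁ q) | inj₁ y<j = inj₂ (w , eq , p , join j y<j p′ q)
    join (suc j) _ (inj₂ (w , eq , p , _)) (inj₂ (w′ , eq′ , _ , q′)) | inj₁ y<j
      with refl ← toℕ-injective (trans eq (sym eq′)) = inj₂ (w , eq , p , q′)
    join (suc j) {y = y} _ p q | inj₂ y≡j = inj₂ (y , y≡j , to-y p , from-y q)
      where
      to-y : ∀ {x} → Via (suc j) x y → Via j x y
      to-y (inj₁ p) = p
      to-y (inj₂ (w , eq , p , _)) with refl ← toℕ-injective (trans eq (sym y≡j)) = p
      from-y : ∀ {z} → Via (suc j) y z → Via j y z
      from-y (inj₁ p) = p
      from-y (inj₂ (w , eq , _ , p)) with refl ← toℕ-injective (trans eq (sym y≡j)) = p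

    complete : ∀ {x y} → Star R x y → Via v x y
    complete ε        = base v (inj₁ refl)
    complete (r ◅ rs) = join v (toℕ<n _) (base v (inj₂ r)) (complete rs)

  star? : Decidable₂ (Star R)
  star? x y = map′ (sound v) complete (via? v x y)

injective? : (f : Fin m → Fin n) → Dec (Injective _≡_ _≡_ f)
injective? f = map′ (λ h {i} {j} → h i j) (λ h i j → h {i} {j})
                    (all? λ i → all? λ j → (f i ≟ f j) →-dec (i ≟ j))

module _ (G : Multigraph v e) where

  joins? : ∀ a x y → Dec (Joins G a x y)
  joins? a x y = ≡-dec _≟_ _≟_ (G a) (x , y) ⊎-dec ≡-dec _≟_ _≟_ (G a) (y , x)

  connected? : Dec (Connected G)
  connected? = all? λ x → all? λ y → star? (λ x y → any? λ a → joins? a x y) x y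

  isCycle? : ∀ {l} (xs : Vec (Fin v) (suc l)) ds → Dec (IsCycle G xs ds)
  isCycle? xs ds = injective? (lookup xs) ×-dec (injective? (lookup ds) ×-dec
    all? (λ i → joins? (lookup ds i) (lookup xs i) _))

  acyclic? : Dec (Acyclic G)
  acyclic? = map′
    (λ none {l} xs ds c → none l (xs , ds , c) (injective⇒≤ (proj₁ c)))
    (λ acyclic l (xs , ds , c) _ → acyclic xs ds c)
    none?
    where
    HasCycle : ℕ → Set
    HasCycle l = Σ (Vec (Fin v) (suc l)) λ xs → ∃[ ds ] IsCycle G xs ds
    hasCycle? : ∀ l → Dec (HasCycle l)
    hasCycle? l = ∃-dec (vectors (allFin v) (suc l)) (∈-vectors ∈-allFin) λ xs →
                  ∃-dec (vectors (allFin e) (suc l)) (∈-vectors ∈-allFin) λ ds → isCycle? xs ds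
    none? : Dec (∀ l → HasCycle l → ¬ (l < v))
    none? = map′ (λ h l c l<v → h l<v c) (λ h {l} l<v c → h l c l<v)
                 (ℕₚ.allUpTo? (λ l → ¬? (hasCycle? l)) v)

  isTree? : Dec (IsTree G)
  isTree? = connected? ×-dec acyclic?

{-# OPTIONS --safe #-}

-- In fact the number of (R₁,…,Rₙ) ∈ 𝓜 for which α(B) is a tree is the same for every fixed vector of
-- indices (i₁,…,i_{k-1}).  When all indices are 1, the map α(-,R₁) permutes each cyclic interval running
-- from one element of the complement of R₁ to just before the next one, so α(B) is a tree exactly when
-- the complement is a singleton.
--
-- It remains to change one index i_t from a to 1.  Fix all the subsets but A = R_a and B = R₁, and fix
-- how often (0, 1 or 2 times) each s ∈ [k] occurs in A and B together.  By the matrix-tree theorem the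
-- tree indicator is an alternating multilinear function of the rows e_u − e_{f(u)}.  Hence, in a
-- difference of the indicators for f(t) = x and f(t) = y, every other row with value x may be moved to y
-- (the only consequence of the theorem that is used, checked directly on functional digraphs).  Let t
-- run upwards through A and through B until it has to stop.  At the first s which does not occur twice
-- the two runs stop together, if s does not occur, or else the two ways of giving s to A or B add up to
-- the same difference for runs starting at s, where s occurs neither in A nor in B.  In the end every
-- difference vanishes.
module Submission where

open import Defs
open import Data.Nat using (ℕ; zero; suc; _≤_; _<_; z≤n; s≤s; _≟_; >-nonZero)
open import Data.Fin using (Fin; zero; suc; toℕ; fromℕ; inject₁)
open import Data.Fin.Subset using (Subset; ∣_∣; ⊤; ⊥; _⊂_; _∈_; _∉_)
open import Data.Product using (Σ-syntax; ∃; ∃-syntax; _×_; _,_; proj₁; proj₂)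
open import Data.Vec using (Vec; []; _∷_; head; lookup; _[_]≔_; zipWith; _∷ʳ_; replicate)
open import Relation.Binary.PropositionalEquality
open import Data.Bool.Base using (Bool; true; false; if_then_else_)
open import Data.Fin.Properties using (all?; fromℕ≢inject₁; inject₁-injective; toℕ-injective; toℕ-fromℕ<; toℕ<n; toℕ≤pred[n]; toℕ-fromℕ) renaming (_≟_ to _≟ᶠ_)
open import Data.Fin.Relation.Unary.Top using (view; ‵fromℕ; ‵inject₁)
open import Data.Fin.Subset.Properties using (∈⊤; ⊆⊤; ∉⊥; _∈?_; _⊂?_; ∣p∣≡n⇒p≡⊤; p⊂q⇒∣p∣<∣q∣; ∣⊤∣≡n)
open import Data.Integer.Base as ℤ using (ℤ; +_; 0ℤ; 1ℤ)
import Data.Integer.Properties as ℤₚ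
open import Data.Integer.Solver using (module +-*-Solver)
open import Data.List.Base as List using (List; []; _∷_; _++_; length; filter; allFin; cartesianProductWith)
open import Data.List.Extrema.Nat using (argmax; f[xs]≤f[argmax])
import Data.List.Membership.Propositional as Membership
open import Data.List.Membership.Propositional.Properties using (∈-allFin)
import Data.List.Relation.Unary.All as All
open import Data.List.Relation.Unary.Any using (here; there)
import Data.Nat.Base as ℕ
import Data.Nat.DivMod as DivMod
import Data.Nat.Properties as ℕₚ
open import Data.Product.Properties using (,-injective)
open import Data.Rational.Base using (_/_)
open import Data.Sum using (_⊎_; inj₁; inj₂; swap)
import Data.Vec.Base as Vec
open import Data.Vec.Properties using ([]=⇒lookup; lookup⇒[]=; lookup∘update; lookup∘update′; lookup-replicate; lookup-zipWith; []≔-lookup; []≔-idempotent)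
open import Function using (_∘_)
open import Relation.Binary.Construct.Closure.ReflexiveTransitive using (Star; ε; _◅_; _◅◅_; reverse)
open import Relation.Nullary using (Dec; yes; no; does; ¬_; ¬?; contradiction)
open import Relation.Nullary.Decidable using (map′; dec-true; dec-false; _×-dec_; _→-dec_)
open import Relation.Unary using (Decidable)

private variable
  A B C P Q : Set
  k m n : ℕ

-- Indicators and pointwise updates

ind : Dec P → ℤ
ind (yes _) = 1ℤ
ind (no _)  = 0ℤ

ind-cong : (P? : Dec P) (Q? : Dec Q) → (P → Q) → (Q → P) → ind P? ≡ ind Q?
ind-cong (yes _) (yes _) _ _ = refl
ind-cong (yes p) (no ¬q) f _ = contradiction (f p) ¬q
ind-cong (no ¬p) (yes q) _ g = contradiction (g q) ¬p
ind-cong (no _)  (no _)  _ _ = refl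

ind-true : (P? : Dec P) → P → ind P? ≡ 1ℤ
ind-true (yes _) _ = refl
ind-true (no ¬p) p = contradiction p ¬p

ind-false : (P? : Dec P) → ¬ P → ind P? ≡ 0ℤ
ind-false (yes p) ¬p = contradiction p ¬p
ind-false (no _)  _  = refl

infixl 10 _[_↦_]
_[_↦_] : (Fin k → A) → Fin k → A → Fin k → A
(f [ t ↦ x ]) u = if does (u ≟ᶠ t) then x else f u

↦-same : (f : Fin k → A) (t : Fin k) (x : A) → (f [ t ↦ x ]) t ≡ x
↦-same f t x rewrite dec-true (t ≟ᶠ t) refl = refl

↦-other : (f : Fin k → A) {t u : Fin k} (x : A) → u ≢ t → (f [ t ↦ x ]) u ≡ f u
↦-other f {t} {u} x u≢t rewrite dec-false (u ≟ᶠ t) u≢t = refl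

↦-self : (f : Fin k → A) (t u : Fin k) → (f [ t ↦ f t ]) u ≡ f u
↦-self f t u with u ≟ᶠ t
... | yes refl = refl
... | no  _    = refl

↦-overwrite : (f : Fin k → A) (t : Fin k) (x y : A) (u : Fin k) → (f [ t ↦ x ] [ t ↦ y ]) u ≡ (f [ t ↦ y ]) u
↦-overwrite f t x y u with u ≟ᶠ t
... | yes _ = refl
... | no  _ = refl

↦-comm : (f : Fin k → A) {s t : Fin k} (x y : A) → s ≢ t → (u : Fin k) →
         (f [ s ↦ x ] [ t ↦ y ]) u ≡ (f [ t ↦ y ] [ s ↦ x ]) u
↦-comm f {s} {t} x y s≢t u with u ≟ᶠ t | u ≟ᶠ s
... | yes refl | yes refl = contradiction refl s≢t
... | yes _    | no  _    = refl
... | no  _    | yes _    = refl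
... | no  _    | no  _    = refl

↦-cong : {f g : Fin k → A} → f ≗ g → (t : Fin k) (x : A) → f [ t ↦ x ] ≗ g [ t ↦ x ]
↦-cong f≗g t x u with u ≟ᶠ t
... | yes _ = refl
... | no  _ = f≗g u

-- Arithmetic modulo `suc m`

toℕ-⊕ : (t : Fin (suc m)) (a : ℕ) → toℕ (t ⊕ a) ≡ (toℕ t ℕ.+ a) DivMod.% suc m
toℕ-⊕ t a = toℕ-fromℕ< _

⊕-assoc : (t : Fin (suc m)) (a b : ℕ) → t ⊕ a ⊕ b ≡ t ⊕ (a ℕ.+ b)
⊕-assoc {m} t a b = toℕ-injective (begin
  toℕ (t ⊕ a ⊕ b)                                          ≡⟨ toℕ-⊕ (t ⊕ a) b ⟩
  (toℕ (t ⊕ a) ℕ.+ b) % suc m                              ≡⟨ %-distribˡ-+ (toℕ (t ⊕ a)) b (suc m) ⟩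
  (toℕ (t ⊕ a) % suc m ℕ.+ b % suc m) % suc m              ≡⟨ cong (λ c → (c % suc m ℕ.+ b % suc m) % suc m) (toℕ-⊕ t a) ⟩
  ((toℕ t ℕ.+ a) % suc m % suc m ℕ.+ b % suc m) % suc m    ≡⟨ cong (λ c → (c ℕ.+ b % suc m) % suc m) (m%n%n≡m%n (toℕ t ℕ.+ a) (suc m)) ⟩
  ((toℕ t ℕ.+ a) % suc m ℕ.+ b % suc m) % suc m            ≡⟨ %-distribˡ-+ (toℕ t ℕ.+ a) b (suc m) ⟨
  (toℕ t ℕ.+ a ℕ.+ b) % suc m                              ≡⟨ cong (_% suc m) (ℕₚ.+-assoc (toℕ t) a b) ⟩
  (toℕ t ℕ.+ (a ℕ.+ b)) % suc m                            ≡⟨ toℕ-⊕ t (a ℕ.+ b) ⟨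
  toℕ (t ⊕ (a ℕ.+ b))                                      ∎)
  where
  open ≡-Reasoning
  open DivMod

⊕-1-m : (t : Fin (suc m)) → t ⊕ 1 ⊕ m ≡ t
⊕-1-m {m} t = trans (⊕-assoc t 1 m) (⊕-period t)

⊕-m-1 : (t : Fin (suc m)) → t ⊕ m ⊕ 1 ≡ t
⊕-m-1 {m} t = trans (⊕-assoc t m 1) (trans (cong (t ⊕_) (ℕₚ.+-comm m 1)) (⊕-period t))

suc-mod : (t : Fin (suc m)) → suc (toℕ t) DivMod.mod suc m ≡ t ⊕ 1
suc-mod {m} t = cong (λ a → a DivMod.mod suc m) (ℕₚ.+-comm 1 (toℕ t))

maximum : (h : Fin (suc m) → ℕ) → ∃[ i ] ∀ j → h j ≤ h i
maximum {m} h = argmax h zero (allFin (suc m)) ,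
  λ j → All.lookup (f[xs]≤f[argmax] {f = h} zero (allFin (suc m))) (∈-allFin j)

-- Rooted functional digraphs

-- The value of f at the root fromℕ m plays no role.
data Reach (f : Fin (suc m) → Fin (suc m)) : Fin (suc m) → Set where
  root : Reach f (fromℕ m)
  step : ∀ {z} → Reach f (f z) → Reach f z

-- The arcs out of the non-root vertices then form a spanning tree directed towards `fromℕ m`.
Rooted : (Fin (suc m) → Fin (suc m)) → Set
Rooted f = ∀ z → Reach f z

reach-cong : {f g : Fin (suc m) → Fin (suc m)} → (∀ u → u ≢ fromℕ m → f u ≡ g u) → ∀ {z} → Reach f z → Reach g z
reach-cong f≗g root = root
reach-cong {m} {f} {g} f≗g (step {z} r) with z ≟ᶠ fromℕ m
... | yes refl = root
... | no  z≢r  = step (subst (Reach g) (f≗g z z≢r) (reach-cong f≗g r))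

reach-next : {f : Fin (suc m) → Fin (suc m)} {z : Fin (suc m)} → Reach f z → z ≢ fromℕ m → Reach f (f z)
reach-next root     z≢r = contradiction refl z≢r
reach-next (step r) _   = r

-- Unlike `Reach`, whose `step` is available at the root too, this admits no step there, so the
-- length of the path is determined by its start.
data Depth (f : Fin (suc m) → Fin (suc m)) : Fin (suc m) → ℕ → Set where
  root : Depth f (fromℕ m) 0
  step : ∀ {z d} → z ≢ fromℕ m → Depth f (f z) d → Depth f z (suc d)

depth-unique : {f : Fin (suc m) → Fin (suc m)} {z : Fin (suc m)} {d d′ : ℕ} → Depth f z d → Depth f z d′ → d ≡ d′
depth-unique root       root       = refl
depth-unique root       (step z≢ _) = contradiction refl z≢
depth-unique (step z≢ _) root       = contradiction refl z≢
depth-unique (step _ p) (step _ q) = cong suc (depth-unique p q)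

reach⇒depth : {f : Fin (suc m) → Fin (suc m)} {z : Fin (suc m)} → Reach f z → ∃ (Depth f z)
reach⇒depth root = 0 , root
reach⇒depth {m} (step {z} r) with z ≟ᶠ fromℕ m
... | yes refl = 0 , root
... | no  z≢r  = let d , p = reach⇒depth r in suc d , step z≢r p

-- Trees as rooted digraphs

module _ {G : Multigraph (suc m) m} {f : Fin (suc m) → Fin (suc m)}
         (G≡ : ∀ t → G t ≡ (inject₁ t , f (inject₁ t))) where

  private
    inject₁≢root : (t : Fin m) → inject₁ t ≢ fromℕ m
    inject₁≢root t eq = fromℕ≢inject₁ (sym eq)

    joins : ∀ {a x y} → Joins G a x y → (x ≡ inject₁ a × y ≡ f x) ⊎ (y ≡ inject₁ a × x ≡ f y)
    joins {a} (inj₁ p) with refl , refl ← ,-injective (trans (sym (G≡ a)) p) = inj₁ (refl , refl)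
    joins {a} (inj₂ p) with refl , refl ← ,-injective (trans (sym (G≡ a)) p) = inj₂ (refl , refl)

    joins-edge : ∀ t → Joins G t (inject₁ t) (f (inject₁ t))
    joins-edge t = inj₁ (G≡ t)

    adjacent-sym : ∀ {x y} → Adjacent G x y → Adjacent G y x
    adjacent-sym (a , inj₁ p) = a , inj₂ p
    adjacent-sym (a , inj₂ p) = a , inj₁ p

    -- Reachability of the root spreads along an edge both ways: forwards since a path out of a
    -- non-root vertex has only one way to begin, backwards by one more arc.
    reach-adjacent : ∀ {x y} → Adjacent G x y → Reach f x → Reach f y
    reach-adjacent (a , j) r with joins j
    ... | inj₁ (refl , refl) = reach-next r (inject₁≢root a)
    ... | inj₂ (_ , refl)    = step r

    reach-star : ∀ {x y} → Star (Adjacent G) x y → Reach f x → Reach f y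
    reach-star ε        r = r
    reach-star (a ◅ as) r = reach-star as (reach-adjacent a r)

    star-root : ∀ {x} → Reach f x → Star (Adjacent G) x (fromℕ m)
    star-root root = ε
    star-root (step {z} r) with view z
    ... | ‵fromℕ     = ε
    ... | ‵inject₁ t = (t , joins-edge t) ◅ star-root r

  connected⇒rooted : Connected G → Rooted f
  connected⇒rooted connected z = reach-star (connected (fromℕ m) z) root

  module _ (rooted : Rooted f) where

    private
      depth : Fin (suc m) → ℕ
      depth z = proj₁ (reach⇒depth (rooted z))

      depth-step : ∀ t → depth (inject₁ t) ≡ suc (depth (f (inject₁ t)))
      depth-step t = depth-unique (proj₂ (reach⇒depth (rooted (inject₁ t))))
                                  (step (inject₁≢root t) (proj₂ (reach⇒depth (rooted (f (inject₁ t))))))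

      -- Depth drops by one along every arc, so an end at least as deep as the other is the tail of
      -- the arc.
      joins-deeper : ∀ {a x y} → Joins G a x y → depth y ≤ depth x → x ≡ inject₁ a × depth x ≡ suc (depth y)
      joins-deeper {a} j y≤x with joins j
      ... | inj₁ (refl , refl) = refl , depth-step a
      ... | inj₂ (refl , refl) = contradiction (subst (_≤ depth (f (inject₁ a))) (depth-step a) y≤x) ℕₚ.1+n≰n

    -- Both cycle edges at a deepest vertex would have to be the edge leaving that vertex.
    rooted⇒acyclic : Acyclic G
    rooted⇒acyclic {l} xs ds (_ , ds-injective , cycle) =
      ℕₚ.1+n≢n (sym (subst (λ y → depth (x i) ≡ suc (depth y)) stuck (proj₂ out)))
      where
      x : Fin (suc l) → Fin (suc m)
      x = lookup xs
      i : Fin (suc l)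
      i = proj₁ (maximum (depth ∘ x))
      deepest : ∀ j → depth (x j) ≤ depth (x i)
      deepest = proj₂ (maximum (depth ∘ x))
      edge : ∀ j → Joins G (lookup ds j) (x j) (x (j ⊕ 1))
      edge j = subst (λ j′ → Joins G (lookup ds j) (x j) (x j′)) (suc-mod j) (cycle j)
      out : x i ≡ inject₁ (lookup ds i) × depth (x i) ≡ suc (depth (x (i ⊕ 1)))
      out = joins-deeper (edge i) (deepest (i ⊕ 1))
      prev-edge : Joins G (lookup ds (i ⊕ l)) (x (i ⊕ l)) (x i)
      prev-edge = subst (λ j → Joins G (lookup ds (i ⊕ l)) (x (i ⊕ l)) (x j)) (⊕-m-1 i) (edge (i ⊕ l))
      into : x i ≡ inject₁ (lookup ds (i ⊕ l))
      into = proj₁ (joins-deeper (swap prev-edge) (deepest (i ⊕ l)))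
      -- The edges of a cycle are distinct, so the two edges at `x i` have the same position and the
      -- cycle is a loop; a loop would make a depth its own successor.
      i≡prev : i ≡ i ⊕ l
      i≡prev = ds-injective (inject₁-injective (trans (sym (proj₁ out)) into))
      stuck : x (i ⊕ 1) ≡ x i
      stuck = cong x (trans (cong (_⊕ 1) i≡prev) (⊕-m-1 i))

    rooted⇒isTree : IsTree G
    rooted⇒isTree = (λ x y → star-root (rooted x) ◅◅ reverse adjacent-sym (star-root (rooted y))) , rooted⇒acyclic

  isTree⇒rooted : IsTree G → Rooted f
  isTree⇒rooted = connected⇒rooted ∘ proj₁

opaque
  rooted? : (f : Fin (suc m) → Fin (suc m)) → Dec (Rooted f)
  rooted? f = map′ (isTree⇒rooted (λ _ → refl)) (rooted⇒isTree (λ _ → refl))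
                   (isTree? (λ t → inject₁ t , f (inject₁ t)))

-- By the matrix-tree theorem, the determinant of the matrix with rows e_u - e_{f(u)} for u other
-- than the root, the column of the root being deleted.
tree : (Fin (suc m) → Fin (suc m)) → ℤ
tree f = ind (rooted? f)

tree-cong-nonroot : {f g : Fin (suc m) → Fin (suc m)} → (∀ u → u ≢ fromℕ m → f u ≡ g u) → tree f ≡ tree g
tree-cong-nonroot {f = f} {g} f≗g = ind-cong (rooted? f) (rooted? g)
  (λ r z → reach-cong f≗g (r z)) (λ r z → reach-cong (λ u u≢ → sym (f≗g u u≢)) (r z))

tree-cong : {f g : Fin (suc m) → Fin (suc m)} → f ≗ g → tree f ≡ tree g
tree-cong f≗g = tree-cong-nonroot (λ u _ → f≗g u)

-- Exchanging values between two rows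

data End : Set where
  atRoot atS atT : End

module _ (f : Fin (suc m) → Fin (suc m)) (s t : Fin (suc m)) where

  -- A path is followed only to the first of the root, s and t, so it does not see the values of f
  -- at s and t. Contracting these paths leaves a digraph on three vertices.
  data Leads : Fin (suc m) → End → Set where
    root  : Leads (fromℕ m) atRoot
    hereS : Leads s atS
    hereT : Leads t atT
    step  : ∀ {z e} → z ≢ fromℕ m → z ≢ s → z ≢ t → Leads (f z) e → Leads z e

  reach⇒leads : ∀ {g} → (∀ u → u ≢ s → u ≢ t → g u ≡ f u) → ∀ {z} → Reach g z → ∃ (Leads z)
  reach⇒leads g≗f root = atRoot , root
  reach⇒leads g≗f (step {z} r) with z ≟ᶠ fromℕ m | z ≟ᶠ s | z ≟ᶠ t
  ... | yes refl | _        | _        = atRoot , root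
  ... | no _     | yes refl | _        = atS , hereS
  ... | no _     | no _     | yes refl = atT , hereT
  ... | no z≢r   | no z≢s   | no z≢t   =
    let e , p = reach⇒leads g≗f r in e , step z≢r z≢s z≢t (subst (λ u → Leads u e) (g≗f z z≢s z≢t) p)

-- Whether the digraph s → e, t → e′ on the two vertices s, t and the root is rooted.
joint : End → End → Bool
joint atS    _      = false
joint atT    atS    = false
joint _      atT    = false
joint atRoot atRoot = true
joint atRoot atS    = true
joint atT    atRoot = true

-- The exchange identity on three vertices, to which `tree-exchange-proper` reduces once every path
-- is contracted to its end.
joint-exchange : ∀ c d → let ⟦_⟧ = λ b → if b then 1ℤ else 0ℤ in
  ⟦ joint c c ⟧ ℤ.- ⟦ joint c d ⟧ ≡ ⟦ joint d c ⟧ ℤ.- ⟦ joint d d ⟧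
joint-exchange atRoot atRoot = refl
joint-exchange atRoot atS    = refl
joint-exchange atRoot atT    = refl
joint-exchange atS    atRoot = refl
joint-exchange atS    atS    = refl
joint-exchange atS    atT    = refl
joint-exchange atT    atRoot = refl
joint-exchange atT    atS    = refl
joint-exchange atT    atT    = refl

module _ (f : Fin (suc m) → Fin (suc m)) {s t : Fin (suc m)} (s≢r : s ≢ fromℕ m) (t≢r : t ≢ fromℕ m) (s≢t : s ≢ t) where

  private
    f⟨_,_⟩ : Fin (suc m) → Fin (suc m) → Fin (suc m) → Fin (suc m)
    f⟨ x , y ⟩ = f [ s ↦ x ] [ t ↦ y ]

    at-t : ∀ x y → f⟨ x , y ⟩ t ≡ y
    at-t x y = ↦-same (f [ s ↦ x ]) t y

    at-s : ∀ x y → f⟨ x , y ⟩ s ≡ x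
    at-s x y = trans (↦-other (f [ s ↦ x ]) y s≢t) (↦-same f s x)

    elsewhere : ∀ x y u → u ≢ s → u ≢ t → f⟨ x , y ⟩ u ≡ f u
    elsewhere x y u u≢s u≢t = trans (↦-other (f [ s ↦ x ]) y u≢t) (↦-other f x u≢s)

  module _ {x y : Fin (suc m)} where

    leads⇒reach : ∀ {z e} → Leads f s t z e → (e ≡ atS → Reach f⟨ x , y ⟩ s) → (e ≡ atT → Reach f⟨ x , y ⟩ t) →
                  Reach f⟨ x , y ⟩ z
    leads⇒reach root  rs rt = root
    leads⇒reach hereS rs rt = rs refl
    leads⇒reach hereT rs rt = rt refl
    leads⇒reach (step {z} _ z≢s z≢t p) rs rt =
      step (subst (Reach _) (sym (elsewhere x y z z≢s z≢t)) (leads⇒reach p rs rt))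

    reach-s : Reach f⟨ x , y ⟩ x → Reach f⟨ x , y ⟩ s
    reach-s r = step (subst (Reach _) (sym (at-s x y)) r)

    reach-t : Reach f⟨ x , y ⟩ y → Reach f⟨ x , y ⟩ t
    reach-t r = step (subst (Reach _) (sym (at-t x y)) r)

    leads-root : ∀ {z e} → Leads f s t z e → z ≡ fromℕ m → e ≡ atRoot
    leads-root root             _   = refl
    leads-root hereS            eq  = contradiction eq s≢r
    leads-root hereT            eq  = contradiction eq t≢r
    leads-root (step z≢r _ _ _) z≡r = contradiction z≡r z≢r

    -- A set of ends closed under the two new arcs and avoiding the root is never left.
    trapped : ∀ {c d} → Leads f s t x c → Leads f s t y d →
              (Bad : End → Set) → ¬ Bad atRoot → (Bad atS → Bad c) → (Bad atT → Bad d) →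
              ∀ {z e} → Reach f⟨ x , y ⟩ z → Leads f s t z e → ¬ Bad e
    trapped x→c y→d Bad ¬bad bad-s bad-t r = go r refl
      where
      -- The vertex is carried along up to an equation, since `f⟨ x , y ⟩ z` equals `x`, `y` or
      -- `f z` only propositionally.
      go : ∀ {z w e} → Reach f⟨ x , y ⟩ z → z ≡ w → Leads f s t w e → ¬ Bad e
      go root     eq   p     bad = ¬bad (subst Bad (leads-root p (sym eq)) bad)
      go (step r) refl root  bad = ¬bad bad
      go (step r) refl hereS bad = go r (at-s x y) x→c (bad-s bad)
      go (step r) refl hereT bad = go r (at-t x y) y→d (bad-t bad)
      go (step {z} r) refl (step _ z≢s z≢t p) bad = go r (elsewhere x y z z≢s z≢t) p bad

    -- Every vertex leads to the root, to s or to t, so the digraph is rooted exactly when s and t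
    -- both reach the root.
    tree-joint : (∀ z → ∃ (Leads f s t z)) → ∀ {c d} → Leads f s t x c → Leads f s t y d →
                 tree f⟨ x , y ⟩ ≡ (if joint c d then 1ℤ else 0ℤ)
    tree-joint leads {c} {d} x→c y→d = go c d x→c y→d
      where
      f′ : Fin (suc m) → Fin (suc m)
      f′ = f⟨ x , y ⟩
      rooted : Reach f′ s → Reach f′ t → Rooted f′
      rooted rs rt z = leads⇒reach (proj₂ (leads z)) (λ _ → rs) (λ _ → rt)
      is-tree : Reach f′ s → Reach f′ t → tree f′ ≡ 1ℤ
      is-tree rs rt = ind-true (rooted? f′) (rooted rs rt)
      no-tree : ∀ {c d} → Leads f s t x c → Leads f s t y d → (Bad : End → Set) →
                ¬ Bad atRoot → (Bad atS → Bad c) → (Bad atT → Bad d) → Bad atS ⊎ Bad atT → tree f′ ≡ 0ℤ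
      no-tree x→c y→d Bad ¬bad bad-s bad-t (inj₁ bad) =
        ind-false (rooted? f′) λ r → trapped x→c y→d Bad ¬bad bad-s bad-t (r s) hereS bad
      no-tree x→c y→d Bad ¬bad bad-s bad-t (inj₂ bad) =
        ind-false (rooted? f′) λ r → trapped x→c y→d Bad ¬bad bad-s bad-t (r t) hereT bad
      go : ∀ c d → Leads f s t x c → Leads f s t y d → tree f′ ≡ (if joint c d then 1ℤ else 0ℤ)
      -- The trapped ends are those on a cycle: s alone, t alone, or both when each leads to the
      -- other.
      go atS    d      p q = no-tree p q (_≡ atS) (λ ()) (λ _ → refl) (λ ()) (inj₁ refl)
      go atRoot atT    p q = no-tree p q (_≡ atT) (λ ()) (λ ()) (λ _ → refl) (inj₂ refl)
      go atT    atT    p q = no-tree p q (_≡ atT) (λ ()) (λ ()) (λ _ → refl) (inj₂ refl)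
      go atT    atS    p q = no-tree p q (_≢ atRoot) (λ ≢ → ≢ refl) (λ _ ()) (λ _ ()) (inj₁ λ ())
      go atRoot atRoot p q = is-tree (reach-s (leads⇒reach p (λ ()) (λ ()))) (reach-t (leads⇒reach q (λ ()) (λ ())))
      go atRoot atS    p q = is-tree rs (reach-t (leads⇒reach q (λ _ → rs) (λ ())))
        where rs = reach-s (leads⇒reach p (λ ()) (λ ()))
      go atT    atRoot p q = is-tree (reach-s (leads⇒reach p (λ ()) (λ _ → rt))) rt
        where rt = reach-t (leads⇒reach q (λ ()) (λ ()))

  -- Sending both s and t to the root tests for cycles that avoid s and t. Without such cycles every
  -- vertex leads to an end and the three-vertex identity applies; otherwise all four terms vanish.
  tree-exchange-proper : ∀ x y → tree f⟨ x , x ⟩ ℤ.- tree f⟨ x , y ⟩ ≡ tree f⟨ y , x ⟩ ℤ.- tree f⟨ y , y ⟩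
  tree-exchange-proper x y with rooted? f⟨ fromℕ m , fromℕ m ⟩
  ... | yes r =
    trans (cong₂ ℤ._-_ (tree-joint leads cx cx) (tree-joint leads cx cy))
    (trans (joint-exchange c d)
    (sym (cong₂ ℤ._-_ (tree-joint leads cy cx) (tree-joint leads cy cy))))
    where
    leads : ∀ z → ∃ (Leads f s t z)
    leads z = reach⇒leads f s t (elsewhere _ _) (r z)
    c = proj₁ (leads x)
    d = proj₁ (leads y)
    cx = proj₂ (leads x)
    cy = proj₂ (leads y)
  ... | no ¬r = cong₂ ℤ._-_ (trans (none x x) (sym (none y x))) (trans (none x y) (sym (none y y)))
    where
    -- Where a path first meets s or t, it is cut short by the arc to the root.
    cut : ∀ {x y z} → Reach f⟨ x , y ⟩ z → Reach f⟨ fromℕ m , fromℕ m ⟩ z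
    cut root = root
    cut {x} {y} (step {z} r) = go (z ≟ᶠ s) (z ≟ᶠ t)
      where
      go : Dec (z ≡ s) → Dec (z ≡ t) → Reach f⟨ fromℕ m , fromℕ m ⟩ z
      go (yes refl) _          = step (subst (Reach _) (sym (at-s _ _)) root)
      go (no _)     (yes refl) = step (subst (Reach _) (sym (at-t _ _)) root)
      go (no z≢s)   (no z≢t)   =
        step (subst (Reach _) (trans (elsewhere x y z z≢s z≢t) (sym (elsewhere _ _ z z≢s z≢t))) (cut r))
    none : ∀ x y → tree f⟨ x , y ⟩ ≡ 0ℤ
    none x y = ind-false (rooted? f⟨ x , y ⟩) λ r → ¬r (λ z → cut (r z))

tree-root-row : (f : Fin (suc m) → Fin (suc m)) (x y : Fin (suc m)) →
                tree (f [ fromℕ m ↦ x ]) ≡ tree (f [ fromℕ m ↦ y ])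
tree-root-row f x y = tree-cong-nonroot λ u u≢r → trans (↦-other f x u≢r) (sym (↦-other f y u≢r))

-- The rows of the reduced Laplacian are e_u − e_{f u}, and its determinant is alternating.
tree-exchange : (f : Fin (suc m) → Fin (suc m)) {s t : Fin (suc m)} → s ≢ t → ∀ x y →
                tree (f [ s ↦ x ] [ t ↦ x ]) ℤ.- tree (f [ s ↦ x ] [ t ↦ y ]) ≡
                tree (f [ s ↦ y ] [ t ↦ x ]) ℤ.- tree (f [ s ↦ y ] [ t ↦ y ])
tree-exchange {m} f {s} {t} s≢t x y with s ≟ᶠ fromℕ m | t ≟ᶠ fromℕ m
... | no s≢r | no t≢r = tree-exchange-proper f s≢r t≢r s≢t x y
-- Changing the value at the root leaves `tree` unchanged: if s is the root, the two sides agree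
-- term by term; if t is, both differences vanish.
... | yes refl | _ = cong₂ ℤ._-_ (flip x) (flip y)
  where
  flip : ∀ z → tree (f [ s ↦ x ] [ t ↦ z ]) ≡ tree (f [ s ↦ y ] [ t ↦ z ])
  flip z = trans (tree-cong (↦-comm f x z s≢t))
          (trans (tree-root-row (f [ t ↦ z ]) x y) (sym (tree-cong (↦-comm f y z s≢t))))
... | no _ | yes refl = trans (cancel x) (sym (cancel y))
  where
  cancel : ∀ z → tree (f [ s ↦ z ] [ t ↦ x ]) ℤ.- tree (f [ s ↦ z ] [ t ↦ y ]) ≡ 0ℤ
  cancel z = ℤₚ.i≡j⇒i-j≡0 (tree-root-row (f [ s ↦ z ]) x y)

-- Differences in one row

infix 8 _⟨_∶_-_⟩
opaque
  _⟨_∶_-_⟩ : (Fin (suc m) → Fin (suc m)) → Fin (suc m) → Fin (suc m) → Fin (suc m) → ℤ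
  f ⟨ t ∶ x - y ⟩ = tree (f [ t ↦ x ]) ℤ.- tree (f [ t ↦ y ])

  ⟨⟩-cong : {f g : Fin (suc m) → Fin (suc m)} → f ≗ g → ∀ t x y → f ⟨ t ∶ x - y ⟩ ≡ g ⟨ t ∶ x - y ⟩
  ⟨⟩-cong f≗g t x y = cong₂ ℤ._-_ (tree-cong (↦-cong f≗g t x)) (tree-cong (↦-cong f≗g t y))

  ⟨⟩-same : (f : Fin (suc m) → Fin (suc m)) (t x : Fin (suc m)) → f ⟨ t ∶ x - x ⟩ ≡ 0ℤ
  ⟨⟩-same f t x = ℤₚ.i≡j⇒i-j≡0 {tree (f [ t ↦ x ])} refl

  ⟨⟩-+ : (f : Fin (suc m) → Fin (suc m)) (t x y z : Fin (suc m)) →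
         f ⟨ t ∶ x - y ⟩ ℤ.+ f ⟨ t ∶ y - z ⟩ ≡ f ⟨ t ∶ x - z ⟩
  ⟨⟩-+ f t x y z = solve 3 (λ a b c → (a :- b) :+ (b :- c) := a :- c) refl (tree (f [ t ↦ x ])) (tree (f [ t ↦ y ])) (tree (f [ t ↦ z ]))
    where open +-*-Solver

  ⟨⟩-def : (f : Fin (suc m) → Fin (suc m)) (t x y : Fin (suc m)) →
           f ⟨ t ∶ x - y ⟩ ≡ tree (f [ t ↦ x ]) ℤ.- tree (f [ t ↦ y ])
  ⟨⟩-def f t x y = refl

  ⟨⟩-overwrite : (f : Fin (suc m) → Fin (suc m)) (t w x y : Fin (suc m)) →
                 f ⟨ t ∶ x - y ⟩ ≡ (f [ t ↦ w ]) ⟨ t ∶ x - y ⟩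
  ⟨⟩-overwrite f t w x y = sym (cong₂ ℤ._-_ (tree-cong (↦-overwrite f t w x)) (tree-cong (↦-overwrite f t w y)))

  ⟨⟩-exchange : (f : Fin (suc m) → Fin (suc m)) {s t : Fin (suc m)} → s ≢ t → ∀ x y →
                (f [ s ↦ x ]) ⟨ t ∶ x - y ⟩ ≡ (f [ s ↦ y ]) ⟨ t ∶ x - y ⟩
  ⟨⟩-exchange = tree-exchange

-- The changes of a row, from a to b, that leave a difference between x and y in another row as it
-- is.
Within : A → A → A → A → Set
Within x y a b = a ≡ b ⊎ ((a ≡ x ⊎ a ≡ y) × (b ≡ x ⊎ b ≡ y))

-- The value at t itself is overwritten in both terms; any other row is switched between x and y by
-- the exchange identity.
⟨⟩-row : (f : Fin (suc m) → Fin (suc m)) (t x y u w : Fin (suc m)) → Within x y (f u) w →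
         f ⟨ t ∶ x - y ⟩ ≡ (f [ u ↦ w ]) ⟨ t ∶ x - y ⟩
⟨⟩-row {m} f t x y u w within with u ≟ᶠ t
... | yes refl = ⟨⟩-overwrite f u w x y
... | no u≢t   = trans (⟨⟩-cong (λ v → sym (↦-self f u v)) t x y) (go within)
  where
  go : ∀ {a b} → Within x y a b → (f [ u ↦ a ]) ⟨ t ∶ x - y ⟩ ≡ (f [ u ↦ b ]) ⟨ t ∶ x - y ⟩
  go (inj₁ refl) = refl
  go (inj₂ (inj₁ refl , inj₁ refl)) = refl
  go (inj₂ (inj₁ refl , inj₂ refl)) = ⟨⟩-exchange f u≢t x y
  go (inj₂ (inj₂ refl , inj₁ refl)) = sym (⟨⟩-exchange f u≢t x y)
  go (inj₂ (inj₂ refl , inj₂ refl)) = refl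

-- The rows of f are turned into those of g one after another; `merge us` is the map reached once
-- the rows in `us` have been changed.
⟨⟩-rows : {f g : Fin (suc m) → Fin (suc m)} {x y : Fin (suc m)} → (∀ u → Within x y (f u) (g u)) →
          ∀ t → f ⟨ t ∶ x - y ⟩ ≡ g ⟨ t ∶ x - y ⟩
⟨⟩-rows {m} {f} {g} {x} {y} within t = trans (merge-⟨⟩ (allFin (suc m))) (⟨⟩-cong (λ u → merged (∈-allFin u)) t x y)
  where
  merge : List (Fin (suc m)) → Fin (suc m) → Fin (suc m)
  merge []       = f
  merge (u ∷ us) = merge us [ u ↦ g u ]
  merge-either : ∀ us u → merge us u ≡ f u ⊎ merge us u ≡ g u
  merge-either []       u = inj₁ refl
  merge-either (v ∷ us) u with u ≟ᶠ v
  ... | yes refl = inj₂ refl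
  ... | no _     = merge-either us u
  merged : ∀ {us u} → u Membership.∈ us → merge us u ≡ g u
  merged {v ∷ us} {u} u∈ with u ≟ᶠ v
  merged {v ∷ us} {u} u∈          | yes refl = refl
  merged {v ∷ us} {u} (here u≡v)  | no u≢v   = contradiction u≡v u≢v
  merged {v ∷ us} {u} (there u∈)  | no _     = merged u∈
  merge-within : ∀ us u → Within x y (merge us u) (g u)
  merge-within us u with merge-either us u
  ... | inj₁ p = subst (λ a → Within x y a (g u)) (sym p) (within u)
  ... | inj₂ p = inj₁ p
  merge-⟨⟩ : ∀ us → f ⟨ t ∶ x - y ⟩ ≡ merge us ⟨ t ∶ x - y ⟩
  merge-⟨⟩ []       = refl
  merge-⟨⟩ (u ∷ us) = trans (merge-⟨⟩ us) (⟨⟩-row (merge us) t x y u (g u) (merge-within us u))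

-- Subsets, runs and `α`

false≢true : false ≢ true
false≢true ()

∈-true : {R : Subset k} {x : Fin k} → x ∈ R → lookup R x ≡ true
∈-true = []=⇒lookup

∉-false : {R : Subset k} {x : Fin k} → x ∉ R → lookup R x ≡ false
∉-false {R = R} {x} x∉R with lookup R x in eq
... | true  = contradiction (lookup⇒[]= x R eq) x∉R
... | false = refl

false-∉ : {R : Subset k} {x : Fin k} → lookup R x ≡ false → x ∉ R
false-∉ eq x∈R = false≢true (trans (sym eq) (∈-true x∈R))

Missing : Subset k → Set
Missing R = ∃[ z ] lookup R z ≡ false

⊂⊤⇒missing : {R : Subset k} → R ⊂ ⊤ → Missing R
⊂⊤⇒missing (_ , z , _ , z∉R) = z , ∉-false z∉R

missing⇒⊂⊤ : {R : Subset k} → Missing R → R ⊂ ⊤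
missing⇒⊂⊤ (z , eq) = ⊆⊤ , z , ∈⊤ , false-∉ eq

[]≔-same : (xs : Vec A k) (i : Fin k) {x : A} → lookup xs i ≡ x → xs [ i ]≔ x ≡ xs
[]≔-same xs i refl = []≔-lookup xs i

-- The offset m - j + z is congruent to z - j - 1 modulo `suc m` and need not be the least one;
-- `suc i` suits runs, which begin at `j ⊕ 1`.
⊕-onto : (j z : Fin (suc m)) → ∃[ i ] j ⊕ suc i ≡ z
⊕-onto {m} j z = m ℕ.∸ toℕ j ℕ.+ toℕ z , toℕ-injective (begin
  toℕ (j ⊕ suc (m ℕ.∸ toℕ j ℕ.+ toℕ z))             ≡⟨ toℕ-⊕ j _ ⟩
  (toℕ j ℕ.+ suc (m ℕ.∸ toℕ j ℕ.+ toℕ z)) % suc m   ≡⟨ cong (_% suc m) (ℕₚ.+-suc (toℕ j) _) ⟩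
  suc (toℕ j ℕ.+ (m ℕ.∸ toℕ j ℕ.+ toℕ z)) % suc m   ≡⟨ cong (λ a → suc a % suc m) (ℕₚ.+-assoc (toℕ j) _ _) ⟨
  suc (toℕ j ℕ.+ (m ℕ.∸ toℕ j) ℕ.+ toℕ z) % suc m   ≡⟨ cong (λ a → suc (a ℕ.+ toℕ z) % suc m) (ℕₚ.m+[n∸m]≡n (toℕ≤pred[n] j)) ⟩
  (suc m ℕ.+ toℕ z) % suc m                         ≡⟨ cong (_% suc m) (ℕₚ.+-comm (suc m) (toℕ z)) ⟩
  (toℕ z ℕ.+ suc m) % suc m                         ≡⟨ [m+n]%n≡m%n (toℕ z) (suc m) ⟩
  toℕ z % suc m                                     ≡⟨ m<n⇒m%n≡m (toℕ<n z) ⟩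
  toℕ z                                             ∎)
  where
  open ≡-Reasoning
  open DivMod

-- That is, o = j + r where j+1,…,j+r ∈ A and j+r+1 ∉ A.
data Launch (A : Subset (suc m)) : Fin (suc m) → Fin (suc m) → Set where
  stop : ∀ {j} → lookup A (j ⊕ 1) ≡ false → Launch A j j
  pass   : ∀ {j o} → lookup A (j ⊕ 1) ≡ true → Launch A (j ⊕ 1) o → Launch A j o

module _ {A : Subset (suc m)} where

  launch-unique : ∀ {j o o′} → Launch A j o → Launch A j o′ → o ≡ o′
  launch-unique (stop _)  (stop _)   = refl
  launch-unique (stop f)  (pass t _)   = contradiction (trans (sym f) t) false≢true
  launch-unique (pass t _)  (stop f)   = contradiction (trans (sym f) t) false≢true
  launch-unique (pass _ p)  (pass _ q)   = launch-unique p q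

  launch-end : ∀ {j o} → Launch A j o → lookup A (o ⊕ 1) ≡ false
  launch-end (stop f) = f
  launch-end (pass _ p) = launch-end p

  private
    -- The missing element at `j ⊕ suc i` bounds the length of the run.
    launch-before : ∀ i j → lookup A (j ⊕ suc i) ≡ false → ∃ (Launch A j)
    launch-before i j eq with lookup A (j ⊕ 1) in at-next
    launch-before i       j eq | false = j , stop at-next
    launch-before zero    j eq | true  = contradiction (trans (sym eq) at-next) false≢true
    launch-before (suc i) j eq | true  =
      let o , p = launch-before i (j ⊕ 1) (trans (cong (lookup A) (⊕-assoc j 1 (suc i))) eq) in o , pass at-next p

  launch-exists : Missing A → ∀ j → ∃ (Launch A j)
  launch-exists (z , eq) j =
    let i , j+i≡z = ⊕-onto j z in launch-before i j (trans (cong (lookup A) j+i≡z) eq)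

  -- A run in A with s added either avoids s, or is cut at s into a run in A that stops at s - 1 and
  -- a run in A from s.
  launch-insert : ∀ {s} → lookup A s ≡ false → ∀ {j o} → Launch (A [ s ]≔ true) j o →
                  Launch A j o ⊎ (Launch A j (s ⊕ m) × Launch A s o)
  launch-insert {s} s∉A (stop {j} f) with j ⊕ 1 ≟ᶠ s
  ... | yes refl = contradiction (trans (sym f) (lookup∘update (j ⊕ 1) A true)) false≢true
  ... | no ≢s    = inj₁ (stop (trans (sym (lookup∘update′ ≢s A true)) f))
  launch-insert {s} s∉A (pass {j} t p) with j ⊕ 1 ≟ᶠ s | launch-insert s∉A p
  ... | no ≢s    | inj₁ q       = inj₁ (pass (trans (sym (lookup∘update′ ≢s A true)) t) q)
  ... | no ≢s    | inj₂ (q , r) = inj₂ (pass (trans (sym (lookup∘update′ ≢s A true)) t) q , r)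
  ... | yes refl | inj₁ q       = inj₂ (subst (Launch A j) (sym (⊕-1-m j)) (stop s∉A) , q)
  ... | yes refl | inj₂ (_ , r) = inj₂ (subst (Launch A j) (sym (⊕-1-m j)) (stop s∉A) , r)

  run⇒launch : ∀ r j → IsRun j A r → Launch A j (j ⊕ r)
  run⇒launch zero    j (_ , end∉) = subst (Launch A j) (sym ⊕-0) (stop (∉-false end∉))
    where
    ⊕-0 : j ⊕ 0 ≡ j
    ⊕-0 = toℕ-injective (trans (toℕ-⊕ j 0) (trans (cong (DivMod._% suc m) (ℕₚ.+-identityʳ (toℕ j))) (DivMod.m<n⇒m%n≡m (toℕ<n j))))
  run⇒launch (suc r) j (in-A , end∉) =
    pass (∈-true (in-A 1 (s≤s z≤n) (s≤s z≤n)))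
       (subst (Launch A (j ⊕ 1)) (⊕-assoc j 1 r)
         (run⇒launch r (j ⊕ 1)
           ( (λ i _ i≤r → subst (_∈ A) (sym (⊕-assoc j 1 i)) (in-A (suc i) (s≤s z≤n) (s≤s i≤r)))
           , subst (_∉ A) (sym (⊕-assoc j 1 (suc r))) end∉)))

α-∈ : (A : Subset (suc m)) {t : Fin (suc m)} → lookup A t ≡ true → α t A ≡ t ⊕ m
α-∈ A {t} t∈ with t ∈? A
... | yes _  = refl
... | no t∉A = contradiction (trans (sym (∉-false t∉A)) t∈) false≢true

α-∉ : (A : Subset (suc m)) {t : Fin (suc m)} → lookup A t ≡ false → Launch A t (α t A)
α-∉ A {t} t∉ with t ∈? A
... | yes t∈A = contradiction (trans (sym t∉) (∈-true t∈A)) false≢true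
... | no t∉A  = run⇒launch _ t (proj₂ (run t A t∉A))

-- Elements of A keep the value u - 1, and s itself changes from `α s A` to s - 1. Any other run
-- changes only if it used to stop at s - 1, and it now goes on to `α s A`.
α-insert : (A : Subset (suc m)) {s : Fin (suc m)} → lookup A s ≡ false → ∀ u →
           Within (α s A) (s ⊕ m) (α u (A [ s ]≔ true)) (α u A)
α-insert A {s} s∉A u with u ≟ᶠ s
... | yes refl = inj₂ (inj₂ (α-∈ (A [ s ]≔ true) (lookup∘update s A true)) , inj₁ refl)
... | no u≢s with lookup A u in eq
...   | true  = inj₁ (trans (α-∈ (A [ s ]≔ true) (trans (lookup∘update′ u≢s A true) eq)) (sym (α-∈ A eq)))
...   | false with launch-insert s∉A (α-∉ (A [ s ]≔ true) {u} (trans (lookup∘update′ u≢s A true) eq))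
...     | inj₁ p       = inj₁ (launch-unique p (α-∉ A eq))
...     | inj₂ (p , q) = inj₂ (inj₁ (launch-unique q (α-∉ A s∉A)) , inj₂ (launch-unique (α-∉ A eq) p))

-- The element following the run from s is missing from A. Since s is the only such element, the run
-- goes all the way round to s - 1.
α-only-missing : (A : Subset (suc m)) {s : Fin (suc m)} → lookup A s ≡ false →
                 ¬ Missing (A [ s ]≔ true) → α s A ≡ s ⊕ m
α-only-missing {m} A {s} s∉A full with α s A ⊕ 1 ≟ᶠ s
... | yes eq = trans (sym (⊕-1-m (α s A))) (cong (_⊕ m) eq)
... | no ≢s  = contradiction (α s A ⊕ 1 , trans (lookup∘update′ ≢s A true) (launch-end (α-∉ A s∉A))) full

-- Removing j makes this meaningful also for j ∈ A.
launch : Fin (suc m) → Subset (suc m) → Fin (suc m)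
launch j A = α j (A [ j ]≔ false)

launch-∉ : (A : Subset (suc m)) {j : Fin (suc m)} → lookup A j ≡ false → launch j A ≡ α j A
launch-∉ A {j} j∉A = cong (α j) ([]≔-same A j j∉A)

launch-insert-self : (A : Subset (suc m)) {j : Fin (suc m)} → lookup A j ≡ false → launch j (A [ j ]≔ true) ≡ α j A
launch-insert-self A {j} j∉A = cong (α j) (trans ([]≔-idempotent A j) ([]≔-same A j j∉A))

launch-correct : (A : Subset (suc m)) → Missing A → ∀ j → Launch A j (launch j A)
launch-correct {m} A missing j with launch-exists missing j | lookup A j in eq
... | _ , _ | false = subst (Launch A j) (sym (launch-∉ A eq)) (α-∉ A eq)
... | o , p | true  = subst (Launch A j) (launch-unique p′ (α-∉ A′ j∉A′)) p
  where
  A′ : Subset (suc m)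
  A′ = A [ j ]≔ false
  j∉A′ : lookup A′ j ≡ false
  j∉A′ = lookup∘update j A false
  p′ : Launch A′ j o
  -- The set A is `A′` with j put back, and whether or not the run crosses j, its last piece runs
  -- from j to o in `A′`.
  p′ with launch-insert {A = A′} j∉A′ (subst (λ B → Launch B j o) (sym (trans ([]≔-idempotent A j) ([]≔-same A j eq))) p)
  ... | inj₁ q       = q
  ... | inj₂ (_ , q) = q

launch-stop : (A : Subset (suc m)) → Missing A → ∀ j → lookup A (j ⊕ 1) ≡ false → launch j A ≡ j
launch-stop A missing j ∉A = launch-unique (launch-correct A missing j) (stop ∉A)

launch-pass : (A : Subset (suc m)) → Missing A → ∀ j → lookup A (j ⊕ 1) ≡ true → launch j A ≡ launch (j ⊕ 1) A
launch-pass A missing j ∈A = launch-unique (launch-correct A missing j) (pass ∈A (launch-correct A missing (j ⊕ 1)))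

-- All indices equal

toℕ-⊕-1 : (z : Fin (suc m)) → suc (toℕ z) ≤ m → toℕ (z ⊕ 1) ≡ suc (toℕ z)
toℕ-⊕-1 {m} z z<m = trans (toℕ-⊕ z 1) (trans (cong (DivMod._% suc m) (ℕₚ.+-comm (toℕ z) 1)) (DivMod.m<n⇒m%n≡m (s≤s z<m)))

toℕ-⊕-m : (z : Fin (suc m)) {y : ℕ} → toℕ z ≡ suc y → toℕ (z ⊕ m) ≡ y
toℕ-⊕-m {m} z {y} eq = begin
  toℕ (z ⊕ m)                    ≡⟨ toℕ-⊕ z m ⟩
  (toℕ z ℕ.+ m) DivMod.% suc m   ≡⟨ cong (λ a → (a ℕ.+ m) DivMod.% suc m) eq ⟩
  suc (y ℕ.+ m) DivMod.% suc m   ≡⟨ cong (DivMod._% suc m) (ℕₚ.+-suc y m) ⟨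
  (y ℕ.+ suc m) DivMod.% suc m   ≡⟨ DivMod.[m+n]%n≡m%n y (suc m) ⟩
  y DivMod.% suc m               ≡⟨ DivMod.m<n⇒m%n≡m (ℕₚ.<-trans (ℕₚ.n<1+n y) (subst (_< suc m) eq (toℕ<n z))) ⟩
  y                              ∎
  where open ≡-Reasoning

-- The arcs count down to 0, whose predecessor modulo `suc m` is the root.
rooted-predecessor : {f : Fin (suc m) → Fin (suc m)} → (∀ z → f z ≡ z ⊕ m) → Rooted f
rooted-predecessor {m} {f} f≡ z = descend (toℕ z) z refl
  where
  descend : ∀ n z → toℕ z ≡ n → Reach f z
  descend zero    z eq = step (subst (Reach f) (sym (trans (f≡ z) z-m)) root)
    where
    z-m : z ⊕ m ≡ fromℕ m
    z-m = toℕ-injective (trans (toℕ-⊕ z m)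
      (trans (cong (λ a → (a ℕ.+ m) DivMod.% suc m) eq) (trans (DivMod.m<n⇒m%n≡m (ℕₚ.n<1+n m)) (sym (toℕ-fromℕ m)))))
  descend (suc n) z eq = step (descend n (f z) (trans (cong toℕ (f≡ z)) (toℕ-⊕-m z eq)))

module _ {R : Subset (suc m)} {c c′ : Fin (suc m)} (c∉R : lookup R c ≡ false) (c′∉R : lookup R c′ ≡ false) where

  private
    -- A run that starts below c′ cannot step onto c′, which is missing from R, and so never wraps
    -- around.
    below : ∀ {z o} → Launch R z o → toℕ z < toℕ c′ → toℕ z ≤ toℕ o × toℕ o < toℕ c′
    below (stop _) z<c′ = ℕₚ.≤-refl , z<c′
    below (pass {z} t p) z<c′ =
      let z+1 = toℕ-⊕-1 z (ℕₚ.≤-trans z<c′ (toℕ≤pred[n] c′))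
          z+1<c′ = ℕₚ.≤∧≢⇒< (subst (_≤ toℕ c′) (sym z+1) z<c′)
                     (λ eq → false≢true (trans (sym c′∉R) (trans (cong (lookup R) (sym (toℕ-injective eq))) t)))
          z+1≤o , o<c′ = below p z+1<c′
      in ℕₚ.≤-trans (ℕₚ.n≤1+n _) (subst (_≤ _) z+1 z+1≤o) , o<c′

  -- α permutes the vertices z with c ≤ z < c′, and the root is not among them.
  trapped-between : ∀ {z} → toℕ c ≤ toℕ z → toℕ z < toℕ c′ → ¬ Reach (λ t → α t R) z
  trapped-between c≤z z<c′ root = ℕₚ.<-irrefl refl (ℕₚ.<-≤-trans z<c′ (subst (toℕ c′ ≤_) (sym (toℕ-fromℕ _)) (toℕ≤pred[n] c′)))
  trapped-between c≤z z<c′ (step {z} r) with lookup R z in eq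
  ... | false = let z≤o , o<c′ = below (α-∉ R eq) z<c′ in trapped-between (ℕₚ.≤-trans c≤z z≤o) o<c′ r
  ... | true  with toℕ z in z≡
  ...   | zero  = contradiction (trans (sym c∉R) (trans (cong (lookup R) (toℕ-injective (trans (ℕₚ.n≤0⇒n≡0 c≤z) (sym z≡)))) eq)) false≢true
  -- Here z is in R and c is not, so c < z and the predecessor of z is still at least c.
  ...   | suc y = trapped-between
                    (subst (toℕ c ≤_) (sym αz) (ℕₚ.≤-pred (ℕₚ.≤∧≢⇒< c≤z c≢z)))
                    (subst (_< toℕ c′) (sym αz) (ℕₚ.<-trans (ℕₚ.n<1+n y) z<c′)) r
    where
    αz : toℕ (α z R) ≡ y
    αz = trans (cong toℕ (α-∈ R eq)) (toℕ-⊕-m z z≡)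
    c≢z : toℕ c ≢ suc y
    c≢z c≡ = false≢true (trans (sym c∉R) (trans (cong (lookup R) (toℕ-injective (trans c≡ (sym z≡)))) eq))

one-missing : (R : Subset k) → ∣ R ∣ < k → Missing R
one-missing (true  ∷ R) (s≤s lt) = let z , eq = one-missing R lt in suc z , eq
one-missing (false ∷ R) _        = zero , refl

two-missing : (R : Subset k) → suc ∣ R ∣ < k →
              ∃[ c ] ∃[ c′ ] (toℕ c < toℕ c′ × lookup R c ≡ false × lookup R c′ ≡ false)
two-missing (true  ∷ R) (s≤s lt) = let c , c′ , c<c′ , eqs = two-missing R lt in suc c , suc c′ , s≤s c<c′ , eqs
two-missing (false ∷ R) (s≤s lt) = let c , eq = one-missing R lt in zero , suc c , s≤s z≤n , refl , eq

∣insert∣ : (R : Subset k) (z : Fin k) → lookup R z ≡ false → ∣ R [ z ]≔ true ∣ ≡ suc ∣ R ∣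
∣insert∣ (false ∷ R) zero    _  = refl
∣insert∣ (true  ∷ R) (suc z) eq = cong suc (∣insert∣ R z eq)
∣insert∣ (false ∷ R) (suc z) eq = ∣insert∣ R z eq

-- If only one element is missing, `α` is the predecessor map, which is rooted. If c < c′ are both
-- missing, no path leaves the interval from c to c′ - 1.
tree-α : (R : Subset (suc m)) → R ⊂ ⊤ → tree (λ t → α t R) ≡ ind (∣ R ∣ ≟ m)
tree-α {m} R R⊂⊤ with ∣ R ∣ ≟ m
... | yes eq = ind-true (rooted? _) (rooted-predecessor predecessor)
  where
  predecessor : ∀ z → α z R ≡ z ⊕ m
  predecessor z with lookup R z in at-z
  ... | true  = α-∈ R at-z
  -- Inserting z raises the cardinality to `suc m`, so z was the only missing element.
  ... | false = α-only-missing R at-z λ (y , y∉) → false≢true (trans (sym y∉)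
    (trans (cong (λ S → lookup S y) (∣p∣≡n⇒p≡⊤ {p = R [ z ]≔ true} (trans (∣insert∣ R z at-z) (cong suc eq)))) (∈-true {R = ⊤ {suc m}} {y} ∈⊤)))
... | no ≢m  = ind-false (rooted? _) not-rooted
  where
  not-rooted : ¬ Rooted (λ t → α t R)
  not-rooted rooted =
    let ∣R∣≤m = ℕₚ.≤-pred (subst (∣ R ∣ <_) (∣⊤∣≡n (suc m)) (p⊂q⇒∣p∣<∣q∣ R⊂⊤))
        c , c′ , c<c′ , c∉R , c′∉R = two-missing R (s≤s (ℕₚ.≤∧≢⇒< ∣R∣≤m ≢m))
    in trapped-between c∉R c′∉R ℕₚ.≤-refl c<c′ (rooted c)

-- Pairs of subsets with prescribed multiplicities

data Degree : Set where
  none one both : Degree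

degree : Bool → Bool → Degree
degree false false = none
degree false true  = one
degree true  false = one
degree true  true  = both

degrees : Subset k → Subset k → Vec Degree k
degrees = zipWith degree

-- Ranges over exactly the pairs with `degrees A B ≡ d`: only an element of degree `one` leaves a
-- choice.
pairSum : Vec Degree k → (Subset k → Subset k → ℤ) → ℤ
pairSum []         g = g [] []
pairSum (none ∷ d) g = pairSum d λ A B → g (false ∷ A) (false ∷ B)
pairSum (one  ∷ d) g = pairSum d λ A B → g (true ∷ A) (false ∷ B) ℤ.+ g (false ∷ A) (true ∷ B)
pairSum (both ∷ d) g = pairSum d λ A B → g (true ∷ A) (true ∷ B)

pairSum-cong : ∀ (d : Vec Degree k) {g h} → (∀ A B → degrees A B ≡ d → g A B ≡ h A B) → pairSum d g ≡ pairSum d h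
pairSum-cong []         g≗h = g≗h [] [] refl
pairSum-cong (none ∷ d) g≗h = pairSum-cong d λ A B eq → g≗h (false ∷ A) (false ∷ B) (cong (none ∷_) eq)
pairSum-cong (one  ∷ d) g≗h = pairSum-cong d λ A B eq →
  cong₂ ℤ._+_ (g≗h (true ∷ A) (false ∷ B) (cong (one ∷_) eq)) (g≗h (false ∷ A) (true ∷ B) (cong (one ∷_) eq))
pairSum-cong (both ∷ d) g≗h = pairSum-cong d λ A B eq → g≗h (true ∷ A) (true ∷ B) (cong (both ∷_) eq)

pairSum-zero : ∀ (d : Vec Degree k) {g} → (∀ A B → degrees A B ≡ d → g A B ≡ 0ℤ) → pairSum d g ≡ 0ℤ
pairSum-zero d g≗0 = trans (pairSum-cong d g≗0) (constant d)
  where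
  constant : ∀ {k} (d : Vec Degree k) → pairSum d (λ _ _ → 0ℤ) ≡ 0ℤ
  constant []         = refl
  constant (none ∷ d) = constant d
  constant (one  ∷ d) = constant d
  constant (both ∷ d) = constant d

-- Isolates the choice at s, so that the two ways of giving s away are compared over one common pair
-- of sets.
pairSum-one : ∀ (d : Vec Degree k) s {g} → lookup d s ≡ one →
              pairSum d g ≡ pairSum (d [ s ]≔ none) λ A B → g (A [ s ]≔ true) B ℤ.+ g A (B [ s ]≔ true)
pairSum-one (one  ∷ d) zero    _  = pairSum-cong d λ _ _ _ → refl
pairSum-one (none ∷ d) (suc s) eq = pairSum-one d s eq
pairSum-one (one  ∷ d) (suc s) {g} eq = trans (pairSum-one d s eq) (pairSum-cong (d [ s ]≔ none) λ A B _ →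
  interchange (g (true ∷ A [ s ]≔ true) (false ∷ B)) (g (false ∷ A [ s ]≔ true) (true ∷ B))
              (g (true ∷ A) (false ∷ B [ s ]≔ true)) (g (false ∷ A) (true ∷ B [ s ]≔ true)))
  where
  interchange : ∀ a b c d → (a ℤ.+ b) ℤ.+ (c ℤ.+ d) ≡ (a ℤ.+ c) ℤ.+ (b ℤ.+ d)
  interchange = solve 4 (λ a b c d → (a :+ b) :+ (c :+ d) := (a :+ c) :+ (b :+ d)) refl
    where open +-*-Solver
pairSum-one (both ∷ d) (suc s) eq = pairSum-one d s eq

pairSum-both : ∀ (d : Vec Degree k) s {g} → lookup d s ≡ both →
               pairSum d g ≡ pairSum (d [ s ]≔ none) λ A B → g (A [ s ]≔ true) (B [ s ]≔ true)
pairSum-both (both ∷ d) zero    _  = refl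
pairSum-both (none ∷ d) (suc s) eq = pairSum-both d s eq
pairSum-both (one  ∷ d) (suc s) eq = pairSum-both d s eq
pairSum-both (both ∷ d) (suc s) eq = pairSum-both d s eq

degrees-lookup : ∀ (A B : Subset k) {d s c} → degrees A B ≡ d → lookup d s ≡ c → degree (lookup A s) (lookup B s) ≡ c
degrees-lookup A B {s = s} refl eq = trans (sym (lookup-zipWith degree s A B)) eq

degree-none : ∀ {a b} → degree a b ≡ none → a ≡ false × b ≡ false
degree-none {false} {false} _ = refl , refl
degree-none {false} {true} ()
degree-none {true} {false} ()
degree-none {true} {true} ()

degree-both : ∀ {a b} → degree a b ≡ both → a ≡ true × b ≡ true
degree-both {true} {true} _ = refl , refl
degree-both {false} {false} ()
degree-both {false} {true} ()
degree-both {true} {false} ()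

both? : (d : Vec Degree k) → (∀ z → lookup d z ≡ both) ⊎ ∃[ z ] lookup d z ≢ both
both? []         = inj₁ λ ()
both? (none ∷ d) = inj₂ (zero , λ ())
both? (one  ∷ d) = inj₂ (zero , λ ())
both? (both ∷ d) with both? d
... | inj₁ all     = inj₁ λ { zero → refl ; (suc z) → all z }
... | inj₂ (z , ≢) = inj₂ (suc z , ≢)

-- Moving a row from one subset to another

missing? : (A : Subset k) → Dec (Missing A)
missing? A = map′ ⊂⊤⇒missing missing⇒⊂⊤ (A ⊂? ⊤)

proper : Subset k → ℤ
proper A = ind (A ⊂? ⊤)

opaque
  -- Strictness of the two subsets enters as a factor, so that `pairSum` can range over all pairs.
  weighted : Subset k → Subset k → ℤ → ℤ
  weighted A B x = proper A ℤ.* proper B ℤ.* x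

  weighted-def : (A B : Subset k) (x : ℤ) → weighted A B x ≡ proper A ℤ.* proper B ℤ.* x
  weighted-def A B x = refl

  weighted-+ : (A B : Subset k) (x y : ℤ) → weighted A B x ℤ.+ weighted A B y ≡ weighted A B (x ℤ.+ y)
  weighted-+ A B x y = sym (ℤₚ.*-distribˡ-+ (proper A ℤ.* proper B) x y)

  weighted-cong : ∀ (A B : Subset k) {x y} → (Missing A → Missing B → x ≡ y) → weighted A B x ≡ weighted A B y
  weighted-cong A B x≡y with A ⊂? ⊤ | B ⊂? ⊤
  ... | yes p | yes q = cong (1ℤ ℤ.*_) (x≡y (⊂⊤⇒missing p) (⊂⊤⇒missing q))
  ... | yes _ | no _  = refl
  ... | no _  | _     = refl

  weighted-zero : ∀ (A B : Subset k) {x} → (Missing A → Missing B → x ≡ 0ℤ) → weighted A B x ≡ 0ℤ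
  weighted-zero A B x≡0 = trans (weighted-cong A B x≡0) (ℤₚ.*-zeroʳ (proper A ℤ.* proper B))

  weighted-yes : ∀ (A B : Subset k) {x} → Missing A → Missing B → weighted A B x ≡ x
  weighted-yes A B {x} p q = trans
    (cong₂ (λ a b → a ℤ.* b ℤ.* x) (ind-true (A ⊂? ⊤) (missing⇒⊂⊤ p)) (ind-true (B ⊂? ⊤) (missing⇒⊂⊤ q))) (ℤₚ.*-identityˡ x)

within-swap : {x y a b : A} → Within x y a b → Within y x a b
within-swap (inj₁ eq)      = inj₁ eq
within-swap (inj₂ (p , q)) = inj₂ (swap p , swap q)

within-sym : {x y a b : A} → Within x y a b → Within x y b a
within-sym (inj₁ eq)      = inj₁ (sym eq)
within-sym (inj₂ (p , q)) = inj₂ (q , p)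

-- Says where a row takes its subset from: one of the two subsets summed over, or one held constant
-- meanwhile.
data Source (k : ℕ) : Set where
  left right : Source k
  fixed      : Subset k → Source k

pick : Source k → Subset k → Subset k → Subset k
pick left      A B = A
pick right     A B = B
pick (fixed R) A B = R

module _ {m} (source : Fin (suc m) → Source (suc m)) (t : Fin (suc m)) where

  private
    V : Set
    V = Fin (suc m)

  arcs : Subset (suc m) → Subset (suc m) → V → V
  arcs A B u = α u (pick (source u) A B)

  private
    row : Subset (suc m) → Subset (suc m) → V → V → ℤ
    row A B x y = arcs A B ⟨ t ∶ x - y ⟩

  -- The row stays t throughout; only the common starting point j of the two runs will move.
  launchDiff : V → Subset (suc m) → Subset (suc m) → ℤ
  launchDiff j A B = weighted A B (arcs A B ⟨ t ∶ launch j A - launch j B ⟩)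

  αDiff : Subset (suc m) → Subset (suc m) → ℤ
  αDiff A B = weighted A B (arcs A B ⟨ t ∶ α t A - α t B ⟩)

  private
    row-≡ : ∀ A B {x y} → x ≡ y → row A B x y ≡ 0ℤ
    row-≡ A B refl = ⟨⟩-same (arcs A B) t _

  module _ (A B : Subset (suc m)) {s : V} where

    arcs-insertˡ : lookup A s ≡ false → ∀ u → Within (α s A) (s ⊕ m) (arcs (A [ s ]≔ true) B u) (arcs A B u)
    arcs-insertˡ s∉A u with source u
    ... | left    = α-insert A s∉A u
    ... | right   = inj₁ refl
    ... | fixed _ = inj₁ refl

    arcs-insertʳ : lookup B s ≡ false → ∀ u → Within (α s B) (s ⊕ m) (arcs A (B [ s ]≔ true) u) (arcs A B u)
    arcs-insertʳ s∉B u with source u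
    ... | left    = inj₁ refl
    ... | right   = α-insert B s∉B u
    ... | fixed _ = inj₁ refl

  -- If s = j + 1 is given to A, the run in A goes on to `α s A` while the run in B stops at j;
  -- given to B, the roles are exchanged. Either insertion switches rows only between the two values
  -- compared, so both differences can be taken for the arcs of A and B, where they telescope
  -- through j.
  launchDiff-one : ∀ A B j → lookup A (j ⊕ 1) ≡ false → lookup B (j ⊕ 1) ≡ false →
                   launchDiff j (A [ j ⊕ 1 ]≔ true) B ℤ.+ launchDiff j A (B [ j ⊕ 1 ]≔ true) ≡ launchDiff (j ⊕ 1) A B
  launchDiff-one A B j s∉A s∉B = begin
    launchDiff j A′ B ℤ.+ launchDiff j A B′           ≡⟨ cong₂ ℤ._+_ in-A in-B ⟩
    row A B (α s A) j ℤ.+ row A B j (α s B)           ≡⟨ ⟨⟩-+ (arcs A B) t (α s A) j (α s B) ⟩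
    row A B (α s A) (α s B)                           ≡⟨ cong₂ (row A B) (launch-∉ A s∉A) (launch-∉ B s∉B) ⟨
    row A B (launch s A) (launch s B)                 ≡⟨ weighted-yes A B (s , s∉A) (s , s∉B) ⟨
    launchDiff s A B                                  ∎
    where
    open ≡-Reasoning
    s : V
    s = j ⊕ 1
    A′ B′ : Subset (suc m)
    A′ = A [ s ]≔ true
    B′ = B [ s ]≔ true
    past : ∀ C → lookup C s ≡ false → Missing (C [ s ]≔ true) → launch j (C [ s ]≔ true) ≡ α s C
    past C s∉C missing = trans (launch-pass (C [ s ]≔ true) missing j (lookup∘update s C true)) (launch-insert-self C s∉C)
    in-A : launchDiff j A′ B ≡ row A B (α s A) j
    in-A with missing? A′
    ... | yes missing = begin
      launchDiff j A′ B                      ≡⟨ weighted-yes A′ B missing (s , s∉B) ⟩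
      row A′ B (launch j A′) (launch j B)    ≡⟨ cong₂ (row A′ B) (past A s∉A missing) (launch-stop B (s , s∉B) j s∉B) ⟩
      row A′ B (α s A) j                     ≡⟨ ⟨⟩-rows (λ u → subst (λ y → Within (α s A) y (arcs A′ B u) (arcs A B u)) (⊕-1-m j) (arcs-insertˡ A B s∉A u)) t ⟩
      row A B (α s A) j                      ∎
    -- If s completes A, the weight is zero on the left, and on the right `α s A` equals s - 1 = j.
    ... | no full = trans (weighted-zero A′ B λ missing _ → contradiction missing full)
                          (sym (row-≡ A B (trans (α-only-missing A s∉A full) (⊕-1-m j))))
    in-B : launchDiff j A B′ ≡ row A B j (α s B)
    in-B with missing? B′
    ... | yes missing = begin
      launchDiff j A B′                      ≡⟨ weighted-yes A B′ (s , s∉A) missing ⟩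
      row A B′ (launch j A) (launch j B′)    ≡⟨ cong₂ (row A B′) (launch-stop A (s , s∉A) j s∉A) (past B s∉B missing) ⟩
      row A B′ j (α s B)                     ≡⟨ ⟨⟩-rows (λ u → within-swap (subst (λ y → Within (α s B) y (arcs A B′ u) (arcs A B u)) (⊕-1-m j) (arcs-insertʳ A B s∉B u))) t ⟩
      row A B j (α s B)                      ∎
    ... | no full = trans (weighted-zero A B′ λ _ missing → contradiction missing full)
                          (sym (row-≡ A B (sym (trans (α-only-missing B s∉B full) (⊕-1-m j)))))

  private
    launchDiff-none : ∀ d j → lookup d (j ⊕ 1) ≡ none → pairSum d (launchDiff j) ≡ 0ℤ
    launchDiff-none d j eq = pairSum-zero d λ A B deg → weighted-zero A B λ p q →
      let s∉A , s∉B = degree-none (degrees-lookup A B deg eq)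
      in row-≡ A B (trans (launch-stop A p j s∉A) (sym (launch-stop B q j s∉B)))

    launchDiff-both : ∀ d j → lookup d (j ⊕ 1) ≡ both → pairSum d (launchDiff j) ≡ pairSum d (launchDiff (j ⊕ 1))
    launchDiff-both d j eq = pairSum-cong d λ A B deg → weighted-cong A B λ p q →
      let s∈A , s∈B = degree-both (degrees-lookup A B deg eq)
      in cong₂ (row A B) (launch-pass A p j s∈A) (launch-pass B q j s∈B)

    launchDiff-single : ∀ d j → lookup d (j ⊕ 1) ≡ one →
                        pairSum d (launchDiff j) ≡ pairSum (d [ j ⊕ 1 ]≔ none) (launchDiff (j ⊕ 1))
    launchDiff-single d j eq = trans (pairSum-one d (j ⊕ 1) eq) (pairSum-cong (d [ j ⊕ 1 ]≔ none) λ A B deg →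
      let s∉A , s∉B = degree-none (degrees-lookup A B deg (lookup∘update (j ⊕ 1) d none))
      in launchDiff-one A B j s∉A s∉B)

    next : ∀ (d : Vec Degree (suc m)) j i {c} → lookup d (j ⊕ suc (suc i)) ≡ c → lookup d (j ⊕ 1 ⊕ suc i) ≡ c
    next d j i eq = trans (cong (lookup d) (⊕-assoc j 1 (suc i))) eq

    update-none : ∀ (d : Vec Degree (suc m)) s z → lookup d z ≡ none → lookup (d [ s ]≔ none) z ≡ none
    update-none d s z eq with z ≟ᶠ s
    ... | yes refl = lookup∘update s d none
    ... | no z≢s   = trans (lookup∘update′ z≢s d none) eq

    -- As j moves forward, an element of degree `both` is passed and one of degree `one` turns into
    -- `none`; i bounds the distance to an element of degree `none`, where both runs stop.
    up-to-none : ∀ i j d → lookup d (j ⊕ suc i) ≡ none → pairSum d (launchDiff j) ≡ 0ℤ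
    up-to-none i j d at-end with lookup d (j ⊕ 1) in eq
    up-to-none i       j d at-end | none = launchDiff-none d j eq
    up-to-none zero    j d at-end | one  = contradiction (trans (sym eq) at-end) λ ()
    up-to-none zero    j d at-end | both = contradiction (trans (sym eq) at-end) λ ()
    up-to-none (suc i) j d at-end | one  = trans (launchDiff-single d j eq)
      (up-to-none i (j ⊕ 1) (d [ j ⊕ 1 ]≔ none) (update-none d (j ⊕ 1) (j ⊕ 1 ⊕ suc i) (next d j i at-end)))
    up-to-none (suc i) j d at-end | both = trans (launchDiff-both d j eq) (up-to-none i (j ⊕ 1) d (next d j i at-end))

    up-to-non-both : ∀ i j d → lookup d (j ⊕ suc i) ≢ both → pairSum d (launchDiff j) ≡ 0ℤ
    up-to-non-both i j d at-end with lookup d (j ⊕ 1) in eq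
    up-to-non-both i       j d at-end | none = launchDiff-none d j eq
    up-to-non-both i       j d at-end | one  = trans (launchDiff-single d j eq)
      -- The element `j ⊕ 1` now has degree `none`, and it is met again after a full turn of `suc m`
      -- steps.
      (up-to-none m (j ⊕ 1) (d [ j ⊕ 1 ]≔ none)
        (trans (cong (lookup (d [ j ⊕ 1 ]≔ none)) (⊕-period (j ⊕ 1))) (lookup∘update (j ⊕ 1) d none)))
    up-to-non-both zero    j d at-end | both = contradiction eq at-end
    up-to-non-both (suc i) j d at-end | both =
      trans (launchDiff-both d j eq) (up-to-non-both i (j ⊕ 1) d (at-end ∘ λ e → trans (cong (lookup d) (sym (⊕-assoc j 1 (suc i)))) e))

  -- If all degrees are `both`, then A is full and every weight is zero; otherwise the walk from j
  -- comes to an element of another degree.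
  launchDiff-zero : ∀ d j → pairSum d (launchDiff j) ≡ 0ℤ
  launchDiff-zero d j with both? d
  ... | inj₁ all = pairSum-zero d λ A B deg → weighted-zero A B λ (z , z∉A) _ →
    contradiction (trans (sym z∉A) (proj₁ (degree-both (degrees-lookup A B deg (all z))))) false≢true
  ... | inj₂ (z , ≢both) =
    let i , eq = ⊕-onto j z in up-to-non-both i j d (≢both ∘ trans (cong (lookup d) (sym eq)))

  -- The value t - 1 from the set that receives t is compared with the run in the other set. Adding
  -- t to that other set as well switches rows only between these two values, so both terms can use
  -- the arcs with t in both sets, where they telescope through t - 1.
  αDiff-one : ∀ A B → lookup A t ≡ false → lookup B t ≡ false →
              αDiff (A [ t ]≔ true) B ℤ.+ αDiff A (B [ t ]≔ true) ≡ launchDiff t (A [ t ]≔ true) (B [ t ]≔ true)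
  αDiff-one A B t∉A t∉B = begin
    αDiff A′ B ℤ.+ αDiff A B′                                          ≡⟨ cong₂ ℤ._+_ in-A in-B ⟩
    w (row A′ B′ (t ⊕ m) b) ℤ.+ w (row A′ B′ a (t ⊕ m))            ≡⟨ weighted-+ A′ B′ (row A′ B′ (t ⊕ m) b) (row A′ B′ a (t ⊕ m)) ⟩
    w (row A′ B′ (t ⊕ m) b ℤ.+ row A′ B′ a (t ⊕ m))                ≡⟨ cong w (ℤₚ.+-comm (row A′ B′ (t ⊕ m) b) _) ⟩
    w (row A′ B′ a (t ⊕ m) ℤ.+ row A′ B′ (t ⊕ m) b)                ≡⟨ cong w (⟨⟩-+ (arcs A′ B′) t a (t ⊕ m) b) ⟩
    w (row A′ B′ a b)                                                ≡⟨ cong₂ (λ x y → w (row A′ B′ x y)) (launch-insert-self A t∉A) (launch-insert-self B t∉B) ⟨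
    launchDiff t A′ B′                                                 ∎
    where
    open ≡-Reasoning
    A′ B′ : Subset (suc m)
    A′ = A [ t ]≔ true
    B′ = B [ t ]≔ true
    w : ℤ → ℤ
    w = weighted A′ B′
    a b : V
    a = α t A
    b = α t B
    in-A : αDiff A′ B ≡ w (row A′ B′ (t ⊕ m) b)
    in-A with missing? A′ | missing? B′
    ... | no full | _ = trans (weighted-zero A′ B λ missing _ → contradiction missing full)
                              (sym (weighted-zero A′ B′ λ missing _ → contradiction missing full))
    -- If t completes B, then `α t B` is t - 1 as well, and both sides vanish.
    ... | yes missing | no full = trans
      (weighted-zero A′ B λ _ _ → row-≡ A′ B (trans (α-∈ A′ (lookup∘update t A true)) (sym (α-only-missing B t∉B full))))
      (sym (weighted-zero A′ B′ λ _ missing → contradiction missing full))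
    ... | yes p | yes q = begin
      αDiff A′ B                  ≡⟨ weighted-yes A′ B p (t , t∉B) ⟩
      row A′ B (α t A′) b         ≡⟨ cong (λ x → row A′ B x b) (α-∈ A′ (lookup∘update t A true)) ⟩
      row A′ B (t ⊕ m) b          ≡⟨ ⟨⟩-rows (λ u → within-swap (within-sym (arcs-insertʳ A′ B t∉B u))) t ⟩
      row A′ B′ (t ⊕ m) b         ≡⟨ weighted-yes A′ B′ p q ⟨
      w (row A′ B′ (t ⊕ m) b)   ∎
    in-B : αDiff A B′ ≡ w (row A′ B′ a (t ⊕ m))
    in-B with missing? A′ | missing? B′
    ... | _ | no full = trans (weighted-zero A B′ λ _ missing → contradiction missing full)
                              (sym (weighted-zero A′ B′ λ _ missing → contradiction missing full))
    ... | no full | yes missing = trans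
      (weighted-zero A B′ λ _ _ → row-≡ A B′ (trans (α-only-missing A t∉A full) (sym (α-∈ B′ (lookup∘update t B true)))))
      (sym (weighted-zero A′ B′ λ missing _ → contradiction missing full))
    ... | yes p | yes q = begin
      αDiff A B′                  ≡⟨ weighted-yes A B′ (t , t∉A) q ⟩
      row A B′ a (α t B′)         ≡⟨ cong (row A B′ a) (α-∈ B′ (lookup∘update t B true)) ⟩
      row A B′ a (t ⊕ m)          ≡⟨ ⟨⟩-rows (λ u → within-sym (arcs-insertˡ A B′ t∉A u)) t ⟩
      row A′ B′ a (t ⊕ m)         ≡⟨ weighted-yes A′ B′ p q ⟨
      w (row A′ B′ a (t ⊕ m))   ∎

  αDiff-zero : ∀ d → pairSum d αDiff ≡ 0ℤ
  αDiff-zero d with lookup d t in eq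
  ... | none = trans (pairSum-cong d λ A B deg →
      let t∉A , t∉B = degree-none (degrees-lookup A B deg eq)
      in cong₂ (λ x y → weighted A B (row A B x y)) (sym (launch-∉ A t∉A)) (sym (launch-∉ B t∉B)))
    (launchDiff-zero d t)
  ... | both = pairSum-zero d λ A B deg → weighted-zero A B λ _ _ →
      let t∈A , t∈B = degree-both (degrees-lookup A B deg eq)
      in row-≡ A B (trans (α-∈ A t∈A) (sym (α-∈ B t∈B)))
  ... | one = begin
      pairSum d αDiff
        ≡⟨ pairSum-one d t eq ⟩
      pairSum (d [ t ]≔ none) (λ A B → αDiff (A [ t ]≔ true) B ℤ.+ αDiff A (B [ t ]≔ true))
        ≡⟨ pairSum-cong (d [ t ]≔ none) (λ A B deg →
             let t∉A , t∉B = degree-none (degrees-lookup A B deg (lookup∘update t d none)) in αDiff-one A B t∉A t∉B) ⟩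
      pairSum (d [ t ]≔ none) (λ A B → launchDiff t (A [ t ]≔ true) (B [ t ]≔ true))
        -- Degree `both` at t describes the pairs in which t has been added to both sets.
        ≡⟨ cong (λ e → pairSum e _) ([]≔-idempotent d t) ⟨
      pairSum ((d [ t ]≔ both) [ t ]≔ none) (λ A B → launchDiff t (A [ t ]≔ true) (B [ t ]≔ true))
        ≡⟨ pairSum-both (d [ t ]≔ both) t (lookup∘update t d both) ⟨
      pairSum (d [ t ]≔ both) (launchDiff t)
        ≡⟨ launchDiff-zero (d [ t ]≔ both) t ⟩
      0ℤ ∎
      where open ≡-Reasoning

-- Sums over lists

∑ : List A → (A → ℤ) → ℤ
∑ []       g = 0ℤ
∑ (x ∷ xs) g = g x ℤ.+ ∑ xs g

∑-cong : ∀ (xs : List A) {g h} → g ≗ h → ∑ xs g ≡ ∑ xs h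
∑-cong []       g≗h = refl
∑-cong (x ∷ xs) g≗h = cong₂ ℤ._+_ (g≗h x) (∑-cong xs g≗h)

∑-zero : ∀ (xs : List A) {g} → (∀ x → g x ≡ 0ℤ) → ∑ xs g ≡ 0ℤ
∑-zero []       g≗0 = refl
∑-zero (x ∷ xs) g≗0 = cong₂ ℤ._+_ (g≗0 x) (∑-zero xs g≗0)

∑-+ : ∀ (xs : List A) g h → ∑ xs (λ x → g x ℤ.+ h x) ≡ ∑ xs g ℤ.+ ∑ xs h
∑-+ []       g h = refl
∑-+ (x ∷ xs) g h = trans (cong (λ s → g x ℤ.+ h x ℤ.+ s) (∑-+ xs g h))
  (solve 4 (λ a b c d → (a :+ b) :+ (c :+ d) := (a :+ c) :+ (b :+ d)) refl (g x) (h x) (∑ xs g) (∑ xs h))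
  where open +-*-Solver

∑-- : ∀ (xs : List A) g h → ∑ xs (λ x → g x ℤ.- h x) ≡ ∑ xs g ℤ.- ∑ xs h
∑-- []       g h = refl
∑-- (x ∷ xs) g h = trans (cong (λ s → g x ℤ.- h x ℤ.+ s) (∑-- xs g h))
  (solve 4 (λ a b c d → (a :- b) :+ (c :- d) := (a :+ c) :- (b :+ d)) refl (g x) (h x) (∑ xs g) (∑ xs h))
  where open +-*-Solver

∑-swap : ∀ (xs : List A) (ys : List B) (g : A → B → ℤ) → ∑ xs (λ x → ∑ ys (g x)) ≡ ∑ ys (λ y → ∑ xs (λ x → g x y))
∑-swap []       ys g = sym (∑-zero ys λ _ → refl)
∑-swap (x ∷ xs) ys g = trans (cong (λ s → ∑ ys (g x) ℤ.+ s) (∑-swap xs ys g))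
                             (sym (∑-+ ys (g x) (λ y → ∑ xs (λ x′ → g x′ y))))

∑-++ : ∀ (xs ys : List A) g → ∑ (xs ++ ys) g ≡ ∑ xs g ℤ.+ ∑ ys g
∑-++ []       ys g = sym (ℤₚ.+-identityˡ _)
∑-++ (x ∷ xs) ys g = trans (cong (λ s → g x ℤ.+ s) (∑-++ xs ys g)) (sym (ℤₚ.+-assoc (g x) _ _))

∑-map : ∀ (f : A → B) xs g → ∑ (List.map f xs) g ≡ ∑ xs (g ∘ f)
∑-map f []       g = refl
∑-map f (x ∷ xs) g = cong (λ s → g (f x) ℤ.+ s) (∑-map f xs g)

∑-cartesianProductWith : ∀ (f : A → B → C) xs ys g →
                         ∑ (cartesianProductWith f xs ys) g ≡ ∑ xs (λ x → ∑ ys (λ y → g (f x y)))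
∑-cartesianProductWith f []       ys g = refl
∑-cartesianProductWith f (x ∷ xs) ys g =
  trans (∑-++ (List.map (f x) ys) _ g) (cong₂ ℤ._+_ (∑-map (f x) ys g) (∑-cartesianProductWith f xs ys g))

∑-filter : ∀ {P : A → Set} (P? : Decidable P) xs g → ∑ (filter P? xs) g ≡ ∑ xs (λ x → ind (P? x) ℤ.* g x)
∑-filter P? []       g = refl
∑-filter P? (x ∷ xs) g with P? x
... | yes _ = cong₂ ℤ._+_ (sym (ℤₚ.*-identityˡ (g x))) (∑-filter P? xs g)
... | no _  = trans (∑-filter P? xs g) (sym (ℤₚ.+-identityˡ _))

length-filter : ∀ {P : A → Set} (P? : Decidable P) xs → + length (filter P? xs) ≡ ∑ xs (ind ∘ P?)
length-filter P? []       = refl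
length-filter P? (x ∷ xs) with P? x
... | yes _ = cong (λ s → 1ℤ ℤ.+ s) (length-filter P? xs)
... | no _  = trans (length-filter P? xs) (sym (ℤₚ.+-identityˡ _))

-- Vectors are grouped by their entries outside place i, and each group contributes zero.
∑-vectors-update : ∀ (xs : List A) (i : Fin n) {g} → (∀ v → ∑ xs (λ x → g (v [ i ]≔ x)) ≡ 0ℤ) → ∑ (vectors xs n) g ≡ 0ℤ
∑-vectors-update {n = suc n} xs zero {g} vanish = begin
  ∑ (vectors xs (suc n)) g                          ≡⟨ ∑-cartesianProductWith _∷_ xs (vectors xs n) g ⟩
  ∑ xs (λ x → ∑ (vectors xs n) (λ v → g (x ∷ v)))   ≡⟨ ∑-swap xs (vectors xs n) (λ x v → g (x ∷ v)) ⟩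
  ∑ (vectors xs n) (λ v → ∑ xs (λ x → g (x ∷ v)))   ≡⟨ ∑-zero (vectors xs n) (λ v → column xs vanish v) ⟩
  0ℤ                                                ∎
  where
  open ≡-Reasoning
  -- `vanish` asks for a full vector: an entry of xs fills the place to be overwritten, and without
  -- entries the sum is empty.
  column : ∀ xs → (∀ v → ∑ xs (λ x → g (v [ zero ]≔ x)) ≡ 0ℤ) → ∀ v → ∑ xs (λ x → g (x ∷ v)) ≡ 0ℤ
  column []       _      v = refl
  column (x ∷ xs) vanish v = vanish (x ∷ v)
∑-vectors-update {n = suc n} xs (suc i) {g} vanish =
  trans (∑-cartesianProductWith _∷_ xs (vectors xs n) g)
        (∑-zero xs λ x → ∑-vectors-update xs i λ v → vanish (x ∷ v))

∑-subsets-suc : ∀ (g : Subset (suc k) → ℤ) →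
                ∑ (subsets (suc k)) g ≡ ∑ (subsets k) (λ R → g (true ∷ R)) ℤ.+ ∑ (subsets k) (λ R → g (false ∷ R))
∑-subsets-suc {k} g = trans (∑-cartesianProductWith _∷_ (true ∷ false ∷ []) (subsets k) g)
  (cong (λ s → ∑ (subsets k) (λ R → g (true ∷ R)) ℤ.+ s) (ℤₚ.+-identityʳ _))

∑∑ : ∀ k → (Subset k → Subset k → ℤ) → ℤ
∑∑ k g = ∑ (subsets k) λ R → ∑ (subsets k) λ S → g R S

∑∑-cong : ∀ {g h : Subset k → Subset k → ℤ} → (∀ R S → g R S ≡ h R S) → ∑∑ k g ≡ ∑∑ k h
∑∑-cong g≗h = ∑-cong (subsets _) λ R → ∑-cong (subsets _) (g≗h R)

∑∑-+ : ∀ (g h : Subset k → Subset k → ℤ) → ∑∑ k (λ R S → g R S ℤ.+ h R S) ≡ ∑∑ k g ℤ.+ ∑∑ k h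
∑∑-+ {k} g h = trans (∑-cong (subsets k) λ R → ∑-+ (subsets k) (g R) (h R))
  (∑-+ (subsets k) (λ R → ∑ (subsets k) (g R)) (λ R → ∑ (subsets k) (h R)))

∑∑-suc : ∀ (g : Subset (suc k) → Subset (suc k) → ℤ) →
  ∑∑ (suc k) g ≡ (∑∑ k (λ R S → g (true ∷ R) (true ∷ S))  ℤ.+ ∑∑ k (λ R S → g (true ∷ R) (false ∷ S))) ℤ.+
                 (∑∑ k (λ R S → g (false ∷ R) (true ∷ S)) ℤ.+ ∑∑ k (λ R S → g (false ∷ R) (false ∷ S)))
∑∑-suc {k} g = trans (∑-subsets-suc (λ R → ∑ (subsets (suc k)) (g R))) (cong₂ ℤ._+_ (half true) (half false))
  where
  half : ∀ b → ∑ (subsets k) (λ R → ∑ (subsets (suc k)) (g (b ∷ R))) ≡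
               ∑∑ k (λ R S → g (b ∷ R) (true ∷ S)) ℤ.+ ∑∑ k (λ R S → g (b ∷ R) (false ∷ S))
  half b = trans (∑-cong (subsets k) λ R → ∑-subsets-suc (g (b ∷ R)))
    (∑-+ (subsets k) (λ R → ∑ (subsets k) (λ S → g (b ∷ R) (true ∷ S))) (λ R → ∑ (subsets k) (λ S → g (b ∷ R) (false ∷ S))))

-- The pairs are grouped by their degrees, and w is constant on each group.
∑∑-pairSum : ∀ (w : Vec Degree k → ℤ) g → (∀ d → pairSum d g ≡ 0ℤ) → ∑∑ k (λ R S → w (degrees R S) ℤ.* g R S) ≡ 0ℤ
∑∑-pairSum {zero} w g vanish =
  trans (ℤₚ.+-identityʳ _) (trans (ℤₚ.+-identityʳ _) (trans (cong (w [] ℤ.*_) (vanish [])) (ℤₚ.*-zeroʳ (w []))))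
∑∑-pairSum {suc k} w g vanish = begin
  ∑∑ (suc k) (λ R S → w (degrees R S) ℤ.* g R S)   ≡⟨ ∑∑-suc {k} _ ⟩
  (tt ℤ.+ tf) ℤ.+ (ft ℤ.+ ff)                      ≡⟨ regroup tt tf ft ff ⟩
  tt ℤ.+ (tf ℤ.+ ft) ℤ.+ ff                        ≡⟨ cong₂ ℤ._+_ (cong₂ ℤ._+_ tt≡0 tf+ft≡0) ff≡0 ⟩
  0ℤ                                               ∎
  where
  open ≡-Reasoning
  part : Bool → Bool → ℤ
  part b c = ∑∑ k (λ R S → w (degree b c ∷ degrees R S) ℤ.* g (b ∷ R) (c ∷ S))
  tt tf ft ff : ℤ
  tt = part true true
  tf = part true false
  ft = part false true
  ff = part false false
  regroup : ∀ a b c d → (a ℤ.+ b) ℤ.+ (c ℤ.+ d) ≡ a ℤ.+ (b ℤ.+ c) ℤ.+ d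
  regroup = solve 4 (λ a b c d → (a :+ b) :+ (c :+ d) := (a :+ (b :+ c)) :+ d) refl
    where open +-*-Solver
  tt≡0 : tt ≡ 0ℤ
  tt≡0 = ∑∑-pairSum (w ∘ (both ∷_)) _ (vanish ∘ (both ∷_))
  ff≡0 : ff ≡ 0ℤ
  ff≡0 = ∑∑-pairSum (w ∘ (none ∷_)) _ (vanish ∘ (none ∷_))
  tf+ft≡0 : tf ℤ.+ ft ≡ 0ℤ
  tf+ft≡0 = trans (sym (∑∑-+ {k} _ _))
    (trans (∑∑-cong λ R S → sym (ℤₚ.*-distribˡ-+ (w (one ∷ degrees R S)) (g (true ∷ R) (false ∷ S)) (g (false ∷ R) (true ∷ S))))
           (∑∑-pairSum (w ∘ (one ∷_)) _ (vanish ∘ (one ∷_))))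

-- Counting memberships

bit : Bool → ℕ
bit false = 0
bit true  = 1

multiplicity : Degree → ℕ
multiplicity none = 0
multiplicity one  = 1
multiplicity both = 2

bit-degree : ∀ a b → bit b ℕ.+ bit a ≡ multiplicity (degree a b)
bit-degree false false = refl
bit-degree false true  = refl
bit-degree true  false = refl
bit-degree true  true  = refl

count-∷ : ∀ (u : Fin k) R (Rs : Vec (Subset k) n) →
          Vec.count (u ∈?_) (R ∷ Rs) ≡ bit (lookup R u) ℕ.+ Vec.count (u ∈?_) Rs
count-∷ u R Rs with u ∈? R
... | yes u∈R rewrite ∈-true u∈R = refl
... | no u∉R rewrite ∉-false u∉R = refl

-- The empty set in place i contributes nothing, so the second summand counts the other entries
-- only.
count-update : ∀ (u : Fin k) (Rs : Vec (Subset k) n) i R →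
               Vec.count (u ∈?_) (Rs [ i ]≔ R) ≡ bit (lookup R u) ℕ.+ Vec.count (u ∈?_) (Rs [ i ]≔ ⊥)
count-update u (S ∷ Rs) zero R = trans (count-∷ u R Rs)
  (cong (bit (lookup R u) ℕ.+_) (sym (trans (count-∷ u ⊥ Rs) (cong (λ b → bit b ℕ.+ Vec.count (u ∈?_) Rs) (∉-false (∉⊥ {x = u}))))))
count-update u (S ∷ Rs) (suc i) R = begin
  Vec.count (u ∈?_) (S ∷ Rs [ i ]≔ R)                   ≡⟨ count-∷ u S (Rs [ i ]≔ R) ⟩
  bit (lookup S u) ℕ.+ Vec.count (u ∈?_) (Rs [ i ]≔ R)  ≡⟨ cong (bit (lookup S u) ℕ.+_) (count-update u Rs i R) ⟩
  bit (lookup S u) ℕ.+ (bit (lookup R u) ℕ.+ rest)      ≡⟨ x∙yz≈y∙xz (bit (lookup S u)) (bit (lookup R u)) rest ⟩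
  bit (lookup R u) ℕ.+ (bit (lookup S u) ℕ.+ rest)      ≡⟨ cong (bit (lookup R u) ℕ.+_) (count-∷ u S (Rs [ i ]≔ ⊥)) ⟨
  bit (lookup R u) ℕ.+ Vec.count (u ∈?_) (S ∷ Rs [ i ]≔ ⊥) ∎
  where
  open ≡-Reasoning
  open import Algebra.Properties.CommutativeSemigroup ℕₚ.+-commutativeSemigroup using (x∙yz≈y∙xz)
  rest : ℕ
  rest = Vec.count (u ∈?_) (Rs [ i ]≔ ⊥)

ind-× : (P? : Dec P) (Q? : Dec Q) → ind (P? ×-dec Q?) ≡ ind P? ℤ.* ind Q?
ind-× (yes _) (yes _) = refl
ind-× (yes _) (no _)  = refl
ind-× (no _)  _       = refl

module _ (p : Fin (suc m) → ℕ) (Rs : Vec (Subset (suc m)) n) (a : Fin n) where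

  -- The conditions of `𝓜` apart from strictness of the two varying subsets; the counts see these
  -- two only through their degrees.
  Rest : Vec Degree (suc m) → Set
  Rest d = (∀ i → i ≢ a → lookup Rs i ⊂ ⊤) ×
           (∀ u → multiplicity (lookup d u) ℕ.+ Vec.count (u ∈?_) (Rs [ a ]≔ ⊥) ≡ p u)

  rest? : ∀ d → Dec (Rest d)
  rest? d = all? (λ i → ¬? (i ≟ᶠ a) →-dec (lookup Rs i ⊂? ⊤)) ×-dec all? (λ u → _ ≟ p u)

  private
    count-pair : ∀ R S u → Vec.count (u ∈?_) (S ∷ Rs [ a ]≔ R) ≡
                 multiplicity (lookup (degrees R S) u) ℕ.+ Vec.count (u ∈?_) (Rs [ a ]≔ ⊥)
    count-pair R S u = begin
      Vec.count (u ∈?_) (S ∷ Rs [ a ]≔ R)                            ≡⟨ count-∷ u S (Rs [ a ]≔ R) ⟩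
      bit (lookup S u) ℕ.+ Vec.count (u ∈?_) (Rs [ a ]≔ R)           ≡⟨ cong (bit (lookup S u) ℕ.+_) (count-update u Rs a R) ⟩
      bit (lookup S u) ℕ.+ (bit (lookup R u) ℕ.+ rest)               ≡⟨ ℕₚ.+-assoc (bit (lookup S u)) _ _ ⟨
      bit (lookup S u) ℕ.+ bit (lookup R u) ℕ.+ rest                 ≡⟨ cong (ℕ._+ rest) (bit-degree (lookup R u) (lookup S u)) ⟩
      multiplicity (degree (lookup R u) (lookup S u)) ℕ.+ rest       ≡⟨ cong (λ c → multiplicity c ℕ.+ rest) (lookup-zipWith degree u R S) ⟨
      multiplicity (lookup (degrees R S) u) ℕ.+ rest                 ∎
      where
      open ≡-Reasoning
      rest : ℕ
      rest = Vec.count (u ∈?_) (Rs [ a ]≔ ⊥)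

  -- Separates a factor that depends on the degrees alone, as `∑∑-pairSum` requires, from
  -- strictness, which becomes the weight.
  ind-∈𝓜 : ∀ R S x → ind ((S ∷ Rs [ a ]≔ R) ∈𝓜? p) ℤ.* x ≡ ind (rest? (degrees R S)) ℤ.* weighted R S x
  ind-∈𝓜 R S x = begin
    ind ((S ∷ Rs [ a ]≔ R) ∈𝓜? p) ℤ.* x                          ≡⟨ cong (ℤ._* x) (ind-cong ((S ∷ Rs [ a ]≔ R) ∈𝓜? p) split? to from) ⟩
    ind split? ℤ.* x                                             ≡⟨ cong (ℤ._* x) (ind-× (rest? (degrees R S)) (R ⊂? ⊤ ×-dec S ⊂? ⊤)) ⟩
    ind (rest? (degrees R S)) ℤ.* ind (R ⊂? ⊤ ×-dec S ⊂? ⊤) ℤ.* x ≡⟨ ℤₚ.*-assoc (ind (rest? (degrees R S))) _ x ⟩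
    ind (rest? (degrees R S)) ℤ.* (ind (R ⊂? ⊤ ×-dec S ⊂? ⊤) ℤ.* x)
      ≡⟨ cong (λ y → ind (rest? (degrees R S)) ℤ.* (y ℤ.* x)) (ind-× (R ⊂? ⊤) (S ⊂? ⊤)) ⟩
    ind (rest? (degrees R S)) ℤ.* (proper R ℤ.* proper S ℤ.* x)  ≡⟨ cong (ind (rest? (degrees R S)) ℤ.*_) (weighted-def R S x) ⟨
    ind (rest? (degrees R S)) ℤ.* weighted R S x                 ∎
    where
    open ≡-Reasoning
    split? : Dec (Rest (degrees R S) × R ⊂ ⊤ × S ⊂ ⊤)
    split? = rest? (degrees R S) ×-dec (R ⊂? ⊤ ×-dec S ⊂? ⊤)
    to : (S ∷ Rs [ a ]≔ R) ∈𝓜 p → Rest (degrees R S) × R ⊂ ⊤ × S ⊂ ⊤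
    to (strict , counts) =
      ( (λ i i≢a → subst (_⊂ ⊤) (lookup∘update′ i≢a Rs R) (strict (suc i)))
      , (λ u → trans (sym (count-pair R S u)) (counts u)))
      , subst (_⊂ ⊤) (lookup∘update a Rs R) (strict (suc a)) , strict zero
    from : Rest (degrees R S) × R ⊂ ⊤ × S ⊂ ⊤ → (S ∷ Rs [ a ]≔ R) ∈𝓜 p
    from ((others , counts) , R⊂⊤ , S⊂⊤) = strict , λ u → trans (count-pair R S u) (counts u)
      where
      strict : ∀ i → lookup (S ∷ Rs [ a ]≔ R) i ⊂ ⊤
      strict zero    = S⊂⊤
      strict (suc i) with i ≟ᶠ a
      ... | yes refl = subst (_⊂ ⊤) (sym (lookup∘update a Rs R)) R⊂⊤
      ... | no i≢a   = subst (_⊂ ⊤) (sym (lookup∘update′ i≢a Rs R)) (others i i≢a)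

-- Independence of the indices

module _ (p : Fin (suc m) → ℕ) where

  -- The root gets an index too, so that `α` yields a map on all of `Fin (suc m)`.
  digraph : Vec (Fin n) (suc m) → Vec (Subset (suc m)) n → Fin (suc m) → Fin (suc m)
  digraph v Rs u = α u (lookup Rs (lookup v u))

  treeCount : Vec (Fin n) (suc m) → ℤ
  treeCount {n} v = ∑ (vectors (subsets (suc m)) n) λ Rs → ind (Rs ∈𝓜? p) ℤ.* tree (digraph v Rs)

  module _ (v : Vec (Fin (suc n)) (suc m)) (t : Fin (suc m)) (a : Fin n) (v-t : lookup v t ≡ suc a) where

    private
      weight : Vec (Fin (suc n)) (suc m) → Vec (Subset (suc m)) (suc n) → ℤ
      weight v Rs = ind (Rs ∈𝓜? p) ℤ.* tree (digraph v Rs)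

      difference : Vec (Subset (suc m)) (suc n) → ℤ
      difference Rs = weight v Rs ℤ.- weight (v [ t ]≔ zero) Rs

    module _ (Rs : Vec (Subset (suc m)) n) where

      private
        -- Row t moves from index `suc a`, the `left` set, to index `zero`, the `right` one.
        sourceOf : Fin (suc n) → Source (suc m)
        sourceOf zero    = right
        sourceOf (suc i) with i ≟ᶠ a
        ... | yes _ = left
        ... | no _  = fixed (lookup Rs i)

        source : Fin (suc m) → Source (suc m)
        source u = sourceOf (lookup v u)

        pick-source : ∀ R S i → pick (sourceOf i) R S ≡ lookup (S ∷ Rs [ a ]≔ R) i
        pick-source R S zero = refl
        pick-source R S (suc i) with i ≟ᶠ a
        ... | yes refl = sym (lookup∘update a Rs R)
        ... | no i≢a   = sym (lookup∘update′ i≢a Rs R)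

        arcs-digraph : ∀ R S u → arcs source t R S u ≡ digraph v (S ∷ Rs [ a ]≔ R) u
        arcs-digraph R S u = cong (α u) (pick-source R S (lookup v u))

        before : ∀ R S → digraph v (S ∷ Rs [ a ]≔ R) ≗ arcs source t R S [ t ↦ α t R ]
        before R S u = sym (begin
          (arcs source t R S [ t ↦ α t R ]) u ≡⟨ cong (λ x → (arcs source t R S [ t ↦ x ]) u) at-t ⟨
          (arcs source t R S [ t ↦ arcs source t R S t ]) u ≡⟨ ↦-self (arcs source t R S) t u ⟩
          arcs source t R S u ≡⟨ arcs-digraph R S u ⟩
          digraph v (S ∷ Rs [ a ]≔ R) u ∎)
          where
          open ≡-Reasoning
          at-t : arcs source t R S t ≡ α t R
          at-t = trans (arcs-digraph R S t)
            (cong (α t) (trans (cong (lookup (S ∷ Rs [ a ]≔ R)) v-t) (lookup∘update a Rs R)))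

        after : ∀ R S → digraph (v [ t ]≔ zero) (S ∷ Rs [ a ]≔ R) ≗ arcs source t R S [ t ↦ α t S ]
        after R S u with u ≟ᶠ t
        ... | yes refl = cong (λ i → α u (lookup (S ∷ Rs [ a ]≔ R) i)) (lookup∘update u v zero)
        ... | no u≢t   = trans (cong (λ i → α u (lookup (S ∷ Rs [ a ]≔ R) i)) (lookup∘update′ u≢t v zero))
                               (sym (arcs-digraph R S u))

        difference-pair : ∀ R S → difference (S ∷ Rs [ a ]≔ R) ≡
                          ind (rest? p Rs a (degrees R S)) ℤ.* αDiff source t R S
        difference-pair R S = begin
          difference (S ∷ Rs [ a ]≔ R)
            ≡⟨ cong₂ (λ x y → i ℤ.* x ℤ.- i ℤ.* y) (tree-cong (before R S)) (tree-cong (after R S)) ⟩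
          i ℤ.* tree (f [ t ↦ α t R ]) ℤ.- i ℤ.* tree (f [ t ↦ α t S ])
            ≡⟨ solve 3 (λ i x y → i :* x :- i :* y := i :* (x :- y)) refl i (tree (f [ t ↦ α t R ])) (tree (f [ t ↦ α t S ])) ⟩
          i ℤ.* (tree (f [ t ↦ α t R ]) ℤ.- tree (f [ t ↦ α t S ]))
            ≡⟨ cong (i ℤ.*_) (⟨⟩-def f t (α t R) (α t S)) ⟨
          i ℤ.* f ⟨ t ∶ α t R - α t S ⟩
            ≡⟨ ind-∈𝓜 p Rs a R S _ ⟩
          ind (rest? p Rs a (degrees R S)) ℤ.* αDiff source t R S ∎
          where
          open ≡-Reasoning
          open +-*-Solver
          i : ℤ
          i = ind ((S ∷ Rs [ a ]≔ R) ∈𝓜? p)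
          f : Fin (suc m) → Fin (suc m)
          f = arcs source t R S

      difference-zero : ∑∑ (suc m) (λ R S → difference (S ∷ Rs [ a ]≔ R)) ≡ 0ℤ
      difference-zero = trans (∑∑-cong difference-pair)
        (∑∑-pairSum (ind ∘ rest? p Rs a) (αDiff source t) (αDiff-zero source t))

    -- With all subsets fixed except those at `zero` and `suc a`, the differences of the tree
    -- indicators already sum to zero over these two.
    treeCount-suc : treeCount v ≡ treeCount (v [ t ]≔ zero)
    treeCount-suc = ℤₚ.i-j≡0⇒i≡j _ _ (begin
      treeCount v ℤ.- treeCount (v [ t ]≔ zero)
        ≡⟨ ∑-- (vectors (subsets (suc m)) (suc n)) (weight v) (weight (v [ t ]≔ zero)) ⟨
      ∑ (vectors (subsets (suc m)) (suc n)) difference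
        ≡⟨ ∑-cartesianProductWith _∷_ (subsets (suc m)) (vectors (subsets (suc m)) n) difference ⟩
      ∑ (subsets (suc m)) (λ S → ∑ (vectors (subsets (suc m)) n) (λ Rs → difference (S ∷ Rs)))
        ≡⟨ ∑-swap (subsets (suc m)) (vectors (subsets (suc m)) n) (λ S Rs → difference (S ∷ Rs)) ⟩
      ∑ (vectors (subsets (suc m)) n) (λ Rs → ∑ (subsets (suc m)) (λ S → difference (S ∷ Rs)))
        ≡⟨ ∑-vectors-update (subsets (suc m)) a {λ Rs → ∑ (subsets (suc m)) (λ S → difference (S ∷ Rs))} difference-zero ⟩
      0ℤ ∎)
      where open ≡-Reasoning

  treeCount-update : ∀ (v : Vec (Fin (suc n)) (suc m)) t → treeCount v ≡ treeCount (v [ t ]≔ zero)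
  treeCount-update v t with lookup v t in eq
  ... | zero  = cong treeCount (sym ([]≔-same v t eq))
  ... | suc a = treeCount-suc v t a eq

-- From index vectors to samples

update-invariant : ∀ {B : Set} {x : A} (F : Vec A n → B) → (∀ v i → F v ≡ F (v [ i ]≔ x)) → ∀ v → F v ≡ F (replicate n x)
update-invariant F inv []      = refl
update-invariant F inv (y ∷ v) = trans (inv (y ∷ v) zero) (update-invariant (F ∘ (_ ∷_)) (λ w i → inv (_ ∷ w) (suc i)) v)

lookup-∷ʳ-inject₁ : ∀ (xs : Vec A n) y i → lookup (xs ∷ʳ y) (inject₁ i) ≡ lookup xs i
lookup-∷ʳ-inject₁ (x ∷ xs) y zero    = refl
lookup-∷ʳ-inject₁ (x ∷ xs) y (suc i) = lookup-∷ʳ-inject₁ xs y i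

-- The appended `zero` is a dummy index for the root, whose arc is not an edge of the graph.
ind-isTree : (is : Vec (Fin (suc n)) m) (Rs : Vec (Subset (suc m)) (suc n)) (p : Fin (suc m) → ℕ) →
             ind (isTree? (graph (is , Rs))) ≡ tree (digraph p (is ∷ʳ zero) Rs)
ind-isTree is Rs p = ind-cong _ (rooted? _) (isTree⇒rooted arcs≡) (rooted⇒isTree arcs≡)
  where
  arcs≡ : ∀ t → graph (is , Rs) t ≡ (inject₁ t , digraph p (is ∷ʳ zero) Rs (inject₁ t))
  arcs≡ t = cong (λ i → inject₁ t , α (inject₁ t) (lookup Rs i)) (sym (lookup-∷ʳ-inject₁ is zero t))

module _ (n : ℕ) (p : Fin (suc m) → ℕ) where

  private
    all : List (Vec (Subset (suc m)) (suc n))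
    all = vectors (subsets (suc m)) (suc n)

    length-samples : ∀ {P : Pairs m (suc n) → Set} (P? : Decidable P) →
      + length (filter P? (samples (suc n) p)) ≡
      ∑ (vectors (allFin (suc n)) m) λ is → ∑ all λ Rs → ind (Rs ∈𝓜? p) ℤ.* ind (P? (is , Rs))
    length-samples P? = trans (length-filter P? (samples (suc n) p))
      (trans (∑-cartesianProductWith _,_ (vectors (allFin (suc n)) m) (𝓜 (suc n) p) _)
             (∑-cong (vectors (allFin (suc n)) m) λ is → ∑-filter (_∈𝓜? p) all _))

    first-index : treeCount p (replicate (suc m) zero) ≡ ∑ all λ Rs → ind (Rs ∈𝓜? p) ℤ.* ind (∣ head Rs ∣ ≟ m)
    first-index = ∑-cong all term
      where
      term : ∀ Rs → ind (Rs ∈𝓜? p) ℤ.* tree (digraph p (replicate (suc m) zero) Rs) ≡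
                    ind (Rs ∈𝓜? p) ℤ.* ind (∣ head Rs ∣ ≟ m)
      term Rs@(R ∷ _) with Rs ∈𝓜? p
      ... | no _ = refl
      -- Membership in `𝓜` supplies the strictness of R that `tree-α` asks for.
      ... | yes (strict , _) = cong (1ℤ ℤ.*_) (trans
        (tree-cong λ u → cong (α u ∘ lookup Rs) (lookup-replicate u zero)) (tree-α R (strict zero)))

  tree-samples : + length (filter (λ B → isTree? (graph B)) (samples (suc n) p)) ≡
                 + length (filter (λ B → ∣ head (proj₂ B) ∣ ≟ m) (samples (suc n) p))
  tree-samples = begin
    + length (filter (λ B → isTree? (graph B)) (samples (suc n) p))
      ≡⟨ length-samples _ ⟩
    ∑ (vectors (allFin (suc n)) m) (λ is → ∑ all λ Rs → ind (Rs ∈𝓜? p) ℤ.* ind (isTree? (graph (is , Rs))))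
      ≡⟨ ∑-cong (vectors (allFin (suc n)) m) fixed-indices ⟩
    ∑ (vectors (allFin (suc n)) m) (λ is → ∑ all λ Rs → ind (Rs ∈𝓜? p) ℤ.* ind (∣ head Rs ∣ ≟ m))
      ≡⟨ length-samples (λ B → ∣ head (proj₂ B) ∣ ≟ m) ⟨
    + length (filter (λ B → ∣ head (proj₂ B) ∣ ≟ m) (samples (suc n) p)) ∎
    where
    open ≡-Reasoning
    -- The counts agree for each index vector separately, after every index has been moved to
    -- `zero`.
    fixed-indices : ∀ is → ∑ all (λ Rs → ind (Rs ∈𝓜? p) ℤ.* ind (isTree? (graph (is , Rs)))) ≡
                           ∑ all (λ Rs → ind (Rs ∈𝓜? p) ℤ.* ind (∣ head Rs ∣ ≟ m))
    fixed-indices is = trans (∑-cong all λ Rs → cong (ind (Rs ∈𝓜? p) ℤ.*_) (ind-isTree is Rs p))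
      (trans (update-invariant (treeCount p) (treeCount-update p) (is ∷ʳ zero)) first-index)

theorem1p6 :
    ∀ (m n : ℕ) → 2 ≤ suc m →
    (p : Fin (suc m) → ℕ) → (∀ t → 1 ≤ p t) →
    (nonempty : Σ[ Rs ∈ Vec (Subset (suc m)) (suc n) ] Rs ∈𝓜 p) →
    ℙ (samples (suc n) p) (samples-nonempty n p nonempty) (λ B → isTree? (graph B))
      ≡ ℙ (samples (suc n) p) (samples-nonempty n p nonempty) (λ B → ∣ head (proj₂ B) ∣ ≟ m)
theorem1p6 m n _ p _ nonempty =
  cong (λ a → (a / length (samples (suc n) p)) {{>-nonZero (samples-nonempty n p nonempty)}}) (tree-samples n p)
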